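{- (1) For every integer $r \geq 3$, $s_{r,r-2}(m)=1$ for all sufficiently large $m$. (2) For every integer $r \geq 3$, $s_{r,r-1}(m)=2$ for all sufficiently large $m$. (3) For every integer $r \geq 3$, $s_{r,r}(m)=\lfloor (m-r+2)/2 \rfloor$ for all sufficiently large $m$. (4) For every integer $r \geq 3$, $s_{r,r+1}(m)=\Theta(m)$. (5) For all integers $r \geq 3$ and $t \geq r+2$, $m^{(t-r+2)/2} \ll s_{r,t}(m) \ll m^{t-r+2}$. (6) For every integer $t \geq 5$, $m^{(t-1)/2} \ll s_{3,t}(m) \ll m^{t-3}$.
   Context: All graphs are finite and simple. For an integer $r\ge 3$, an $r$-system is a pair $(H,\mathcal{F})$ where $H$ is a graph and $\mathcal{F}$ is a family (possibly with repeated members) of subsets of $V(H)$ such that: (i) $H$ contains no $K_r$; (ii) every $S\in\mathcal{F}$ is maximally $K_{r-1}$-free, i.e. $H[S]$ contains no $K_{r-1}$ but $H[S\cup\{v\}]$ contains a $K_{r-1}$ for every vertex $v\notin S$; (iii) for any two distinct members $S\neq T$ of $\mathcal{F}$, $H[S\cap T]$ contains a $K_{r-2}$. For integers $r\ge3$, $t\ge r-2$, an $(r,t)$-system is an $r$-system in which $\mathcal{F}$ has no repeated elements and every set in $\mathcal{F}$ has size exactly $t$. For integers $m\ge 0$, $s_{r,t}(m)$ is the maximum of $|\mathcal{F}|$ over all $(r,t)$-systems $(H,\mathcal{F})$ with $|V(H)|=m$. Notation: $f\ll g$ means $f=O(g)$, and $f=\Theta(g)$ means $f\ll g$ and $g\ll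 f$, as $m\to\infty$ with $r,t$ fixed (constants may depend on $r,t$). -}

module Defs where

open import Data.Nat using (ℕ; _∸_; _+_; _*_; _^_; _≤_; ⌊_/2⌋)
open import Data.Bool using (Bool; true; false)
open import Data.Fin using (Fin)
open import Data.Fin.Subset using (Subset; _∈_; _∉_; _∩_; _∪_; ⁅_⁆; ⊤; ∣_∣)
open import Data.List using (List; length)
import Data.List.Membership.Propositional as LM
open import Data.List.Relation.Unary.Unique.Propositional using (Unique)
open import Data.Product using (Σ; _×_)
open import Function.Definitions using (Injective)
open import Relation.Binary.PropositionalEquality using (_≡_; _≢_)
open import Relation.Nullary using (¬_)

record Graph (m : ℕ) : Set where
  field
    adj    : Fin m → Fin m → Bool
    sym    : ∀ i j → adj i j ≡ adj j i
    irrefl : ∀ i → adj i i ≡ false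
open Graph public

HasClique : ∀ {m} → Graph m → Subset m → ℕ → Set
HasClique {m} H S k =
  Σ (Fin k → Fin m) λ f →
    Injective _≡_ _≡_ f ×
    (∀ i → f i ∈ S) ×
    (∀ i j → i ≢ j → adj H (f i) (f j) ≡ true)

MaximallyFree : ∀ {m} → Graph m → ℕ → Subset m → Set
MaximallyFree {m} H k S =
  ¬ HasClique H S k × (∀ (v : Fin m) → v ∉ S → HasClique H (S ∪ ⁅ v ⁆) k)

record System (r t m : ℕ) : Set where
  field
    H        : Graph m
    F        : List (Subset m)
    noKr     : ¬ HasClique H ⊤ r
    maxFree  : ∀ {S} → S LM.∈ F → MaximallyFree H (r ∸ 1) S
    pairwise : ∀ {S T} → S LM.∈ F → T LM.∈ F → S ≢ T → HasClique H (S ∩ T) (r ∸ 2)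
    unique   : Unique F
    sizes    : ∀ {S} → S LM.∈ F → ∣ S ∣ ≡ t
open System public

size : ∀ {r t m} → System r t m → ℕ
size Σ' = length (F Σ')

sIs : ℕ → ℕ → ℕ → ℕ → Set
sIs r t m n = Σ (System r t m) (λ X → size X ≡ n) × (∀ (X : System r t m) → size X ≤ n)

{-# OPTIONS --safe #-}
-- Write r = 2 + k.  If S and T in the family agree outside one vertex each, these two vertices
-- are adjacent, so a (t-1)-set lies in at most r - 1 members.
--
-- Upper bounds.  All members meet a fixed one in a k-clique, so up to a constant factor one may
-- fix a k-clique K and count the members K ∪ P; this already gives m^(t-r+2).  For |P| ≤ 3, either
-- boundedly many vertices meet every P, or there is a large sunflower with kernel K whose petals
-- have equal adjacency patterns.  Its petal vertices must then all miss the same single vertex p of K, and the rest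
-- of K is joined to the whole graph, which reduces to r = 3 with L = K: the graph is triangle-free
-- outside L and the petals are independent dominating sets there.  Petals of size two then form a
-- crown, hence are disjoint; of three vertices of a petal of size three one lies in boundedly many
-- petals, which gives a linear bound, and for r = 3 one fixes further vertices to reach m^(t-3).
--
-- Lower bounds.  Coning reduces to r = 3.  There, take a triangle-free graph with many maximal
-- independent sets of size t - 1, an isolated centre, and spare vertices hung on the centre.
-- Crowns give ⌊n/2⌋ sets of size two; a cyclic blow-up of C_k, k = t - 1 ≥ 4, with q² vertices in
-- each part has the q^k closed words of length k as maximal independent sets.
module Submission where

open import Defs renaming (sym to adj-sym)
open import Data.Bool using (Bool; true; false)
import Data.Bool.Properties as Bool
open import Data.Empty using (⊥; ⊥-elim)
open import Data.Fin using (Fin; zero; suc; inject≤; combine; remQuot; fromℕ; inject₁; finToFun; funToFin; toℕ)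
open import Data.Fin.Patterns using (0F; 1F; 2F)
import Data.Fin.Properties as Fin
open import Data.Fin.Relation.Unary.Top using (view; ‵fromℕ; ‵inject₁)
open import Data.Fin.Subset using (Subset; _∈_; _∉_; _∩_; ⁅_⁆; ⊤; ∣_∣)
open import Data.Fin.Subset.Properties using (_∈?_; ∈⊤; x∈⁅x⁆; x∈⁅y⁆⇒x≡y; x∈p∩q⁺; x∈p∩q⁻; x∈p∪q⁺; x∈p∪q⁻; ⊆-antisym)
open import Data.List using (List; []; _∷_; _++_; length; map; filter; tabulate; allFin; lookup; cartesianProductWith; concat; cartesianProduct)
import Data.List.Membership.DecPropositional as DecMembership
open import Data.List.Membership.Propositional using (find; lose) renaming (_∈_ to _∈ˡ_; _∉_ to _∉ˡ_)
open import Data.List.Membership.Propositional.Properties using (∈-∃++; ∈-filter⁺; ∈-filter⁻; ∈-map⁺; ∈-map⁻; ∈-++⁺ˡ; ∈-++⁺ʳ; ∈-++⁻; ∈-tabulate⁺; ∈-tabulate⁻; ∈-allFin; ∈-lookup; ∈-cartesianProductWith⁺; ∈-cartesianProductWith⁻; ∈-concat⁺′; ∈-cartesianProduct⁺)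
open import Data.List.Properties using (length-map; length-++; length-tabulate; length-++-sucʳ)
open import Data.List.Relation.Binary.Subset.Propositional using () renaming (_⊆_ to _⊆ˡ_)
open import Data.List.Relation.Unary.All using (All; []; _∷_; all?)
import Data.List.Relation.Unary.All as All
import Data.List.Relation.Unary.All.Properties as All
open import Data.List.Relation.Unary.AllPairs using (AllPairs; []; _∷_; allPairs?)
import Data.List.Relation.Unary.AllPairs as AllPairs
import Data.List.Relation.Unary.AllPairs.Properties as AllPairs
open import Data.List.Relation.Unary.Any using (Any; here; there; any?)
import Data.List.Relation.Unary.Any as Any
open import Data.List.Relation.Unary.Any.Properties using (lookup-index)
open import Data.List.Relation.Unary.Unique.Propositional using (Unique)
import Data.List.Relation.Unary.Unique.Propositional.Properties as Unique
open import Data.Nat using (ℕ; zero; suc; _∸_; _+_; _*_; _^_; _≤_; _<_; z≤n; s≤s; s≤s⁻¹; ⌊_/2⌋; >-nonZero)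
open import Data.Nat.Properties
open import Data.Nat.Tactic.RingSolver using (solve-∀)
open import Data.Product using (Σ; ∃; ∃₂; _×_; _,_; proj₁; proj₂)
open import Data.Sum using (_⊎_; inj₁; inj₂; [_,_]′)
import Data.Sum as Sum
open import Data.Vec using ([]; _∷_)
import Data.Vec as Vec
open import Data.Vec.Base using () renaming (here to hereᵛ; there to thereᵛ)
open import Data.Vec.Properties using (≡-dec)
import Data.Vec.Properties as Vec
open import Function using (_∘_; id; case_of_; mk⇔)
open import Relation.Binary.PropositionalEquality using (_≡_; _≢_; refl; sym; trans; cong; cong₂; subst; ≢-sym)
open import Relation.Nullary using (¬_; Dec; yes; no; contradiction; ¬?; does)
open import Relation.Nullary.Decidable using (_×-dec_; decidable-stable; does-⇔; _⊎-dec_)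
open import Relation.Unary using (Decidable)

-- Fixing K costs a factor t^k, harmless for orders of magnitude but not for the exact value in (3).
-- There the alternative outcome of the count is an inequality about the whole family: a sunflower
-- with more than t petals over K forces K into every member, so one link carries all of them and
-- |K| + 2|F| ≤ m follows. Without such an outcome the family has bounded size, and m is taken large
-- enough for that. The single missed vertex p comes from moving cliques between petals. If the
-- vertices in the same position of two petals are not adjacent, one is dominated by a k-clique
-- consisting of kernel vertices and vertices of the other petal. All petals have the same pattern,
-- so this clique has a copy in every petal, and it avoids the position in question. Petals of two
-- or three vertices leave so few other positions that counting determines what is missed. The
-- exponent (t-r+2)/2: a blow-up with c parts has c q² vertices and q^c sets, which is of order
-- m^(c/2), and coning preserves t - r.

private variable
  A B I Q : Set
  m : ℕ

-- Counting in lists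

length-filter-filter : {P R : A → Set} (P? : Decidable P) (R? : Decidable R) (xs : List A) →
  length (filter P? (filter R? xs)) ≤ length (filter P? xs)
length-filter-filter P? R? [] = z≤n
length-filter-filter P? R? (x ∷ xs) with R? x
... | yes _ with P? x
...   | yes _ = s≤s (length-filter-filter P? R? xs)
...   | no _ = length-filter-filter P? R? xs
length-filter-filter P? R? (x ∷ xs) | no _ with P? x
...   | yes _ = m≤n⇒m≤1+n (length-filter-filter P? R? xs)
...   | no _ = length-filter-filter P? R? xs

length-filter-split : {P : A → Set} (P? : Decidable P) (xs : List A) →
  length xs ≡ length (filter P? xs) + length (filter (¬? ∘ P?) xs)
length-filter-split P? [] = refl
length-filter-split P? (x ∷ xs) with P? x
... | yes _ = cong suc (length-filter-split P? xs)
... | no _ = trans (cong suc (length-filter-split P? xs)) (sym (+-suc _ _))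

-- The alternative Q threads a positive outcome through a counting argument,
-- so that "too many sets" can be turned into a configuration without classical logic.
union-bound : {P : I → A → Set} (P? : ∀ i → Decidable (P i)) (is : List I) (xs : List A) {b : ℕ} →
  (∀ {x} → x ∈ˡ xs → ∃ λ i → i ∈ˡ is × P i x) →
  (∀ {i} → i ∈ˡ is → length (filter (P? i) xs) ≤ b ⊎ Q) →
  length xs ≤ length is * b ⊎ Q
union-bound P? [] [] cov small = inj₁ z≤n
union-bound P? [] (x ∷ xs) cov small with cov (here refl)
... | _ , () , _
union-bound {P = P} P? (i ∷ is) xs {b} cov small with small (here refl)
... | inj₂ q = inj₂ q
... | inj₁ fewᵢ with union-bound P? is rest cov′ small′
  where
  rest = filter (¬? ∘ P? i) xs
  cov′ : ∀ {x} → x ∈ˡ rest → ∃ λ j → j ∈ˡ is × P j x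
  cov′ x∈ with ∈-filter⁻ (¬? ∘ P? i) {xs = xs} x∈
  ... | x∈xs , ¬p with cov x∈xs
  ...   | _ , here refl , p = contradiction p ¬p
  ...   | j , there j∈ , p = j , j∈ , p
  small′ : ∀ {j} → j ∈ˡ is → length (filter (P? j) rest) ≤ b ⊎ _
  small′ {j} j∈ with small (there j∈)
  ... | inj₁ le = inj₁ (≤-trans (length-filter-filter (P? j) (¬? ∘ P? i) xs) le)
  ... | inj₂ q = inj₂ q
... | inj₂ q = inj₂ q
... | inj₁ few = inj₁ (≤-trans (≤-reflexive (length-filter-split (P? i) xs)) (+-mono-≤ fewᵢ few))

union-bound′ : {P : I → A → Set} (P? : ∀ i → Decidable (P i)) (is : List I) (xs : List A) {b : ℕ} →
  (∀ {x} → x ∈ˡ xs → ∃ λ i → i ∈ˡ is × P i x) →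
  (∀ {i} → i ∈ˡ is → length (filter (P? i) xs) ≤ b) →
  length xs ≤ length is * b
union-bound′ P? is xs cov small with union-bound {Q = ⊥} P? is xs cov (inj₁ ∘ small)
... | inj₁ le = le

-- Splitting the list by each test in turn leaves at most 2^|is| classes on which all tests are
-- constant. The hypothesis ranges over all sublists because the classes only emerge at the bottom
-- of the recursion.
uniform-bound : (g : I → A → Bool) (is : List I) (xs : List A) {b : ℕ} → Unique xs →
  (∀ ys → Unique ys → ys ⊆ˡ xs →
     (∀ {i x y} → i ∈ˡ is → x ∈ˡ ys → y ∈ˡ ys → g i x ≡ g i y) → length ys ≤ b ⊎ Q) →
  length xs ≤ 2 ^ length is * b ⊎ Q
uniform-bound g [] xs {b} uniq bound with bound xs uniq id (λ ())
... | inj₁ le = inj₁ (≤-trans le (≤-reflexive (sym (+-identityʳ b))))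
... | inj₂ q = inj₂ q
uniform-bound {Q = Q} g (i ∷ is) xs {b} uniq bound
  with uniform-bound {Q = Q} g is (filter T? xs) {b} (Unique.filter⁺ T? uniq) bound₁
     | uniform-bound {Q = Q} g is (filter (¬? ∘ T?) xs) {b} (Unique.filter⁺ (¬? ∘ T?) uniq) bound₂
  where
  T? = λ x → g i x Bool.≟ true
  bound₁ : ∀ ys → Unique ys → ys ⊆ˡ filter T? xs → _ → length ys ≤ b ⊎ Q
  bound₁ ys uys sub uni = bound ys uys (proj₁ ∘ ∈-filter⁻ T? ∘ sub) λ where
    (here refl) x∈ y∈ → trans (proj₂ (∈-filter⁻ T? {xs = xs} (sub x∈)))
                              (sym (proj₂ (∈-filter⁻ T? {xs = xs} (sub y∈))))
    (there i∈) → uni i∈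
  bound₂ : ∀ ys → Unique ys → ys ⊆ˡ filter (¬? ∘ T?) xs → _ → length ys ≤ b ⊎ Q
  bound₂ ys uys sub uni = bound ys uys (proj₁ ∘ ∈-filter⁻ (¬? ∘ T?) ∘ sub) λ where
    (here refl) x∈ y∈ → trans (Bool.¬-not (proj₂ (∈-filter⁻ (¬? ∘ T?) {xs = xs} (sub x∈))))
                              (sym (Bool.¬-not (proj₂ (∈-filter⁻ (¬? ∘ T?) {xs = xs} (sub y∈)))))
    (there i∈) → uni i∈
... | inj₂ q | _ = inj₂ q
... | inj₁ _ | inj₂ q = inj₂ q
... | inj₁ le₁ | inj₁ le₂ = inj₁ (≤-trans (≤-reflexive (length-filter-split (λ x → g i x Bool.≟ true) xs))
  (≤-trans (+-mono-≤ le₁ le₂) (≤-reflexive (trans (sym (*-distribʳ-+ b p p)) (cong (_* b) (cong (p +_) (sym (+-identityʳ p))))))))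
  where p = 2 ^ length is

∈∷⁻ : {x y : A} {xs : List A} → x ∈ˡ y ∷ xs → x ≢ y → x ∈ˡ xs
∈∷⁻ (here eq) neq = contradiction eq neq
∈∷⁻ (there x∈) _ = x∈

∉₀ : {x y : A} {xs : List A} → x ∉ˡ y ∷ xs → x ≢ y
∉₀ x∉ = x∉ ∘ here

∉₁ : {x y z : A} {xs : List A} → x ∉ˡ y ∷ z ∷ xs → x ≢ z
∉₁ x∉ p = x∉ (there (here p))

∉₂ : {w x y z : A} {xs : List A} → w ∉ˡ x ∷ y ∷ z ∷ xs → w ≢ z
∉₂ w∉ p = w∉ (there (there (here p)))

∷-unique : {x : A} {xs : List A} → x ∉ˡ xs → Unique xs → Unique (x ∷ xs)
∷-unique x∉ u = All.¬Any⇒All¬ _ x∉ ∷ u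

unique-length-≤ : {xs ys : List A} → Unique xs → xs ⊆ˡ ys → length xs ≤ length ys
unique-length-≤ {xs = []} _ _ = z≤n
unique-length-≤ {xs = x ∷ xs} u@(_ ∷ uxs) sub with ∈-∃++ (sub (here refl))
... | as , bs , refl = ≤-trans (s≤s (unique-length-≤ uxs sub′)) (≤-reflexive (sym (length-++-sucʳ as x bs)))
  where
  sub′ : xs ⊆ˡ as ++ bs
  sub′ z∈ with ∈-++⁻ as (sub (there z∈))
  ... | inj₁ z∈as = ∈-++⁺ˡ z∈as
  ... | inj₂ (here refl) = contradiction z∈ (Unique.Unique[x∷xs]⇒x∉xs u)
  ... | inj₂ (there z∈bs) = ∈-++⁺ʳ as z∈bs

unique-constant-length-≤1 : {xs : List A} → Unique xs → (∀ {x y} → x ∈ˡ xs → y ∈ˡ xs → x ≡ y) → length xs ≤ 1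
unique-constant-length-≤1 {xs = []} _ _ = z≤n
unique-constant-length-≤1 {xs = x ∷ []} _ _ = s≤s z≤n
unique-constant-length-≤1 {xs = x ∷ y ∷ _} ((x≢y ∷ _) ∷ _) eq = contradiction (eq (here refl) (there (here refl))) x≢y

allPairs-∈ : {R : A → A → Set} {xs : List A} → Unique xs →
  (∀ {x y} → x ∈ˡ xs → y ∈ˡ xs → x ≢ y → R x y) → AllPairs R xs
allPairs-∈ [] r = []
allPairs-∈ (≢x ∷ u) r =
  All.tabulate (λ y∈ → r (here refl) (there y∈) (All.lookup ≢x y∈)) ∷
  allPairs-∈ u (λ x∈ y∈ → r (there x∈) (there y∈))

lookupPair : {R : A → A → Set} → (∀ {x y} → R x y → R y x) → {xs : List A} → AllPairs R xs →
  ∀ {x y} → x ∈ˡ xs → y ∈ˡ xs → x ≢ y → R x y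
lookupPair s (_ ∷ _) (here refl) (here refl) neq = contradiction refl neq
lookupPair s (r ∷ _) (here refl) (there y∈) neq = All.lookup r y∈
lookupPair s (r ∷ _) (there x∈) (here refl) neq = s (All.lookup r x∈)
lookupPair s (_ ∷ rs) (there x∈) (there y∈) neq = lookupPair s rs x∈ y∈ neq

-- The relation is required of all witnesses, so one witness per element may be chosen without
-- coordination. This turns a list of sets into a clique, or into a list of distinct vertices.
choose-allPairs : {P : A → B → Set} {R : B → B → Set} {xs : List A} →
  (∀ {x} → x ∈ˡ xs → ∃ (P x)) →
  AllPairs (λ x y → ∀ b c → P x b → P y c → R b c) xs →
  ∃ λ bs → AllPairs R bs × length bs ≡ length xs × (∀ {b} → b ∈ˡ bs → ∃ λ x → x ∈ˡ xs × P x b)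
choose-allPairs {xs = []} _ _ = [] , [] , refl , λ ()
choose-allPairs {xs = x ∷ xs} ch (r ∷ rs) with ch (here refl) | choose-allPairs {xs = xs} (ch ∘ there) rs
... | b , pb | bs , ap , len , orig =
  b ∷ bs ,
  All.tabulate (λ c∈ → let (y , y∈ , pc) = orig c∈ in All.lookup r y∈ _ _ pb pc) ∷ ap ,
  cong suc len ,
  λ { (here refl) → x , here refl , pb ; (there c∈) → let (y , y∈ , pc) = orig c∈ in y , there y∈ , pc }

-- The failing pair keeps its D, so that two petals found in this way are still known to meet only
-- in the kernel.
allPairs⊎counterexample : {D R : A → A → Set} (R? : ∀ x y → Dec (R x y)) {xs : List A} → AllPairs D xs →
  AllPairs R xs ⊎ (∃₂ λ x y → x ∈ˡ xs × y ∈ˡ xs × D x y × ¬ R x y)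
allPairs⊎counterexample R? [] = inj₁ []
allPairs⊎counterexample R? {x ∷ xs} (d ∷ ds) with allPairs⊎counterexample R? ds
... | inj₂ (y , z , y∈ , z∈ , c) = inj₂ (y , z , there y∈ , there z∈ , c)
... | inj₁ rs with all? (R? x) xs
...   | yes r = inj₁ (r ∷ rs)
...   | no ¬r with find (All.¬All⇒Any¬ (R? x) xs ¬r)
...     | y , y∈ , ¬Rxy = inj₂ (x , y , here refl , there y∈ , All.lookup d y∈ , ¬Rxy)

length-cartesianProductWith : {C : Set} (f : A → B → C) (xs : List A) (ys : List B) →
  length (cartesianProductWith f xs ys) ≡ length xs * length ys
length-cartesianProductWith f [] ys = refl
length-cartesianProductWith f (x ∷ xs) ys =
  trans (length-++ (map (f x) ys)) (cong₂ _+_ (length-map (f x) ys) (length-cartesianProductWith f xs ys))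

tuples : ℕ → List A → List (List A)
tuples zero xs = [] ∷ []
tuples (suc n) xs = cartesianProductWith _∷_ xs (tuples n xs)

length-tuples : (n : ℕ) (xs : List A) → length (tuples n xs) ≡ length xs ^ n
length-tuples zero xs = refl
length-tuples (suc n) xs = trans (length-cartesianProductWith _∷_ xs (tuples n xs)) (cong (length xs *_) (length-tuples n xs))

∈-tuples⁺ : (n : ℕ) {xs ws : List A} → length ws ≡ n → ws ⊆ˡ xs → ws ∈ˡ tuples n xs
∈-tuples⁺ zero {ws = []} refl sub = here refl
∈-tuples⁺ (suc n) {ws = w ∷ ws} eq sub =
  ∈-cartesianProductWith⁺ _∷_ (sub (here refl)) (∈-tuples⁺ n (suc-injective eq) (sub ∘ there))

∈-tuples⁻-length : (n : ℕ) {xs ws : List A} → ws ∈ˡ tuples n xs → length ws ≡ n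
∈-tuples⁻-length zero (here refl) = refl
∈-tuples⁻-length (suc n) {xs} ws∈ with ∈-cartesianProductWith⁻ _∷_ xs (tuples n xs) ws∈
... | _ , _ , _ , vs∈ , refl = cong suc (∈-tuples⁻-length n vs∈)

-- Vertex sets and cliques

_∈ˡ?_ : (x : Fin m) (xs : List (Fin m)) → Dec (x ∈ˡ xs)
_∈ˡ?_ = DecMembership._∈?_ Fin._≟_

unique-tight : {xs ys : List (Fin m)} → Unique xs → xs ⊆ˡ ys → length ys ≤ length xs → ys ⊆ˡ xs
unique-tight {xs = xs} {ys} u sub le {y} y∈ with y ∈ˡ? xs
... | yes y∈xs = y∈xs
... | no y∉xs = contradiction (unique-length-≤ (∷-unique y∉xs u) λ { (here refl) → y∈ ; (there z∈) → sub z∈ })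
                              (<⇒≱ (s≤s le))

infix 4 _⊑_
_⊑_ : List (Fin m) → Subset m → Set
L ⊑ S = ∀ {x} → x ∈ˡ L → x ∈ S

∷-⊑ : {x : Fin m} {L : List (Fin m)} {S : Subset m} → x ∈ S → L ⊑ S → (x ∷ L) ⊑ S
∷-⊑ x∈ sub (here refl) = x∈
∷-⊑ x∈ sub (there y∈) = sub y∈

members : Subset m → List (Fin m)
members [] = []
members (true ∷ S) = zero ∷ map suc (members S)
members (false ∷ S) = map suc (members S)

∈-members⁺ : {S : Subset m} {x : Fin m} → x ∈ S → x ∈ˡ members S
∈-members⁺ {S = true ∷ S} hereᵛ = here refl
∈-members⁺ {S = true ∷ S} (thereᵛ x∈) = there (∈-map⁺ suc (∈-members⁺ x∈))
∈-members⁺ {S = false ∷ S} (thereᵛ x∈) = ∈-map⁺ suc (∈-members⁺ x∈)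

members-⊑ : (S : Subset m) → members S ⊑ S
members-⊑ (true ∷ S) (here refl) = hereᵛ
members-⊑ (true ∷ S) (there x∈) with ∈-map⁻ suc x∈
... | _ , y∈ , refl = thereᵛ (members-⊑ S y∈)
members-⊑ (false ∷ S) x∈ with ∈-map⁻ suc x∈
... | _ , y∈ , refl = thereᵛ (members-⊑ S y∈)

members-unique : (S : Subset m) → Unique (members S)
members-unique [] = []
members-unique (true ∷ S) = ∷-unique (λ z∈ → case ∈-map⁻ suc z∈ of λ { (_ , _ , ()) }) (Unique.map⁺ Fin.suc-injective (members-unique S))
members-unique (false ∷ S) = Unique.map⁺ Fin.suc-injective (members-unique S)

length-members : (S : Subset m) → length (members S) ≡ ∣ S ∣
length-members [] = refl
length-members (true ∷ S) = cong suc (trans (length-map suc (members S)) (length-members S))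
length-members (false ∷ S) = trans (length-map suc (members S)) (length-members S)

unique-⊑-length : {L : List (Fin m)} {S : Subset m} → Unique L → L ⊑ S → length L ≤ ∣ S ∣
unique-⊑-length {S = S} u sub = ≤-trans (unique-length-≤ u (∈-members⁺ ∘ sub)) (≤-reflexive (length-members S))

⊑-tight : {L : List (Fin m)} {S : Subset m} → Unique L → L ⊑ S → ∣ S ∣ ≤ length L → ∀ {x} → x ∈ S → x ∈ˡ L
⊑-tight {S = S} u sub le x∈ = unique-tight u (∈-members⁺ ∘ sub) (≤-trans (≤-reflexive (length-members S)) le) (∈-members⁺ x∈)

subset-determined : {L : List (Fin m)} {S T : Subset m} → Unique L → L ⊑ S → L ⊑ T →
  ∣ S ∣ ≤ length L → ∣ T ∣ ≤ length L → S ≡ T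
subset-determined u LS LT s t = ⊆-antisym (LT ∘ ⊑-tight u LS s) (LS ∘ ⊑-tight u LT t)

petal : List (Fin m) → Subset m → List (Fin m)
petal L S = filter (λ x → ¬? (x ∈ˡ? L)) (members S)

∈-petal⁺ : {L : List (Fin m)} {S : Subset m} {x : Fin m} → x ∈ S → x ∉ˡ L → x ∈ˡ petal L S
∈-petal⁺ {L = L} x∈ x∉ = ∈-filter⁺ (λ x → ¬? (x ∈ˡ? L)) (∈-members⁺ x∈) x∉

∈-petal⁻ : {L : List (Fin m)} {S : Subset m} {x : Fin m} → x ∈ˡ petal L S → x ∈ S × x ∉ˡ L
∈-petal⁻ {L = L} {S} x∈ = let (p , q) = ∈-filter⁻ (λ x → ¬? (x ∈ˡ? L)) {xs = members S} x∈ in members-⊑ S p , q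

petal-unique : (L : List (Fin m)) (S : Subset m) → Unique (petal L S)
petal-unique L S = Unique.filter⁺ (λ x → ¬? (x ∈ˡ? L)) (members-unique S)

length-petal : {L : List (Fin m)} {S : Subset m} → Unique L → L ⊑ S → length L + length (petal L S) ≡ ∣ S ∣
length-petal {L = L} {S} u sub = ≤-antisym
  (≤-trans (≤-reflexive (sym (length-++ L)))
    (unique-⊑-length (Unique.++⁺ u (petal-unique L S) (λ (x∈L , x∈P) → proj₂ (∈-petal⁻ {L = L} {S} x∈P) x∈L)) both))
  (≤-trans (≤-reflexive (sym (length-members S)))
    (≤-trans (unique-length-≤ (members-unique S) split) (≤-reflexive (length-++ L))))
  where
  both : (L ++ petal L S) ⊑ S
  both x∈ with ∈-++⁻ L x∈
  ... | inj₁ x∈L = sub x∈L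
  ... | inj₂ x∈P = proj₁ (∈-petal⁻ {L = L} x∈P)
  split : members S ⊆ˡ L ++ petal L S
  split {x} x∈ with x ∈ˡ? L
  ... | yes x∈L = ∈-++⁺ˡ x∈L
  ... | no x∉L = ∈-++⁺ʳ L (∈-petal⁺ (members-⊑ S x∈) x∉L)

petal-size : {L : List (Fin m)} {S : Subset m} {d : ℕ} → Unique L → L ⊑ S → ∣ S ∣ ≡ length L + d → length (petal L S) ≡ d
petal-size {L = L} u sub size = +-cancelˡ-≡ (length L) _ _ (trans (length-petal u sub) size)

Adj : Graph m → Fin m → Fin m → Set
Adj H x y = adj H x y ≡ true

-- Lists replace the injections of `HasClique` because they can be filtered, joined and extended;
-- distinctness comes for free, as there are no loops.
Clique : Graph m → List (Fin m) → Set
Clique H = AllPairs (Adj H)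

module _ (H : Graph m) where

  adj? : ∀ x y → Dec (Adj H x y)
  adj? x y = adj H x y Bool.≟ true

  flip : ∀ {x y} → Adj H x y → Adj H y x
  flip {x} {y} e = trans (adj-sym H y x) e

  loopless : ∀ {x} → ¬ Adj H x x
  loopless {x} e = case trans (sym e) (irrefl H x) of λ ()

  adj⇒≢ : ∀ {x y} → Adj H x y → x ≢ y
  adj⇒≢ e refl = loopless e

  clique-unique : ∀ {W} → Clique H W → Unique W
  clique-unique = AllPairs.map adj⇒≢

  clique-∷ : ∀ {x W} → (∀ {w} → w ∈ˡ W → Adj H x w) → Clique H W → Clique H (x ∷ W)
  clique-∷ e c = All.tabulate e ∷ c

  clique-lookup : ∀ {W} → Clique H W → ∀ {x y} → x ∈ˡ W → y ∈ˡ W → x ≢ y → Adj H x y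
  clique-lookup = lookupPair flip

  clique⇒HasClique : ∀ {n W S} → Clique H W → W ⊑ S → n ≤ length W → HasClique H S n
  clique⇒HasClique {W = W} c sub le = f , inj , (λ i → sub (∈-lookup (inject≤ i le))) , edge
    where
    f = λ i → lookup W (inject≤ i le)
    lookup-adj : ∀ {V} → Clique H V → ∀ i j → i ≢ j → Adj H (lookup V i) (lookup V j)
    lookup-adj (_ ∷ _) zero zero neq = contradiction refl neq
    lookup-adj (e ∷ _) zero (suc j) _ = All.lookup e (∈-lookup j)
    lookup-adj (e ∷ _) (suc i) zero _ = flip (All.lookup e (∈-lookup i))
    lookup-adj (_ ∷ es) (suc i) (suc j) neq = lookup-adj es i j (neq ∘ cong suc)
    edge : ∀ i j → i ≢ j → Adj H (f i) (f j)
    edge i j neq = lookup-adj c _ _ (neq ∘ Fin.inject≤-injective le le i j)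
    inj : ∀ {i j} → f i ≡ f j → i ≡ j
    inj {i} {j} eq with i Fin.≟ j
    ... | yes p = p
    ... | no neq = contradiction eq (adj⇒≢ (edge i j neq))

  HasClique⇒clique : ∀ {n S} → HasClique H S n → ∃ λ W → Clique H W × W ⊑ S × length W ≡ n
  HasClique⇒clique (f , _ , f∈ , edge) =
    tabulate f , AllPairs.tabulate⁺ (λ neq → edge _ _ neq) ,
    (λ x∈ → case ∈-tabulate⁻ x∈ of λ { (i , refl) → f∈ i }) , length-tabulate f

-- Members of a system: domination, degrees and sunflowers

module Facts {k t m : ℕ} (X : System (2 + k) t m) where

  infix 4 _~_
  _~_ : Fin m → Fin m → Set
  _~_ = Adj (H X)

  free-bound : ∀ {S W} → S ∈ˡ F X → Clique (H X) W → W ⊑ S → length W ≤ k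
  free-bound S∈ c sub = ≮⇒≥ λ lt → proj₁ (maxFree X S∈) (clique⇒HasClique (H X) c sub lt)

  clique-bound : ∀ {W} → Clique (H X) W → length W ≤ suc k
  clique-bound c = ≮⇒≥ λ lt → noKr X (clique⇒HasClique (H X) c (λ _ → ∈⊤) lt)

  -- S has no (k+1)-clique, so the one in S ∪ {v} uses v; deleting v leaves at least k vertices of
  -- S, all joined to v.
  dominated : ∀ {S v} → S ∈ˡ F X → v ∉ S →
    ∃ λ W → Clique (H X) W × W ⊑ S × k ≤ length W × (∀ {w} → w ∈ˡ W → v ~ w)
  dominated {S} {v} S∈ v∉ with HasClique⇒clique (H X) (proj₂ (maxFree X S∈) v v∉)
  ... | V , c , sub , len with v ∈ˡ? V
  ...   | no v∉V = contradiction (free-bound S∈ c V⊑S) (<⇒≱ (≤-reflexive (sym len)))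
    where
    V⊑S : V ⊑ S
    V⊑S x∈ with x∈p∪q⁻ S ⁅ v ⁆ (sub x∈)
    ... | inj₁ x∈S = x∈S
    ... | inj₂ x∈v = contradiction (subst (_∈ˡ V) (x∈⁅y⁆⇒x≡y v x∈v) x∈) v∉V
  ...   | yes v∈V = W , AllPairs.filter⁺ ≢v? c , W⊑S , k≤W , λ w∈ → clique-lookup (H X) c v∈V (W⁻ w∈ .proj₁) (≢-sym (W⁻ w∈ .proj₂))
    where
    ≢v? = λ x → ¬? (x Fin.≟ v)
    W = filter ≢v? V
    W⁻ : ∀ {w} → w ∈ˡ W → w ∈ˡ V × w ≢ v
    W⁻ = ∈-filter⁻ ≢v? {xs = V}
    W⊑S : W ⊑ S
    W⊑S w∈ with W⁻ w∈
    ... | w∈V , w≢v with x∈p∪q⁻ S ⁅ v ⁆ (sub w∈V)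
    ...   | inj₁ w∈S = w∈S
    ...   | inj₂ w∈v = contradiction (x∈⁅y⁆⇒x≡y v w∈v) w≢v
    V⊆ : V ⊆ˡ v ∷ W
    V⊆ {x} x∈ with x Fin.≟ v
    ... | yes eq = here eq
    ... | no neq = there (∈-filter⁺ ≢v? x∈ neq)
    k≤W : k ≤ length W
    k≤W = s≤s⁻¹ (≤-trans (≤-reflexive (sym len)) (unique-length-≤ (clique-unique (H X) c) V⊆))

  record Above (L : List (Fin m)) (ys : List (Subset m)) : Set where
    constructor above
    field
      distinct : Unique ys
      inF      : ys ⊆ˡ F X
      kernel   : ∀ {S} → S ∈ˡ ys → L ⊑ S
  open Above public

  above-filter : ∀ {L ys} {P : Subset m → Set} (P? : Decidable P) → Above L ys → Above L (filter P? ys)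
  above-filter P? a = above (Unique.filter⁺ P? (distinct a)) (inF a ∘ proj₁ ∘ ∈-filter⁻ P?) (kernel a ∘ proj₁ ∘ ∈-filter⁻ P?)

  above-full : ∀ {L ys} → Unique L → Above L ys → length L ≡ t → length ys ≤ 1
  above-full u a len = unique-constant-length-≤1 (distinct a) λ S∈ T∈ →
    subset-determined u (kernel a S∈) (kernel a T∈)
      (≤-reflexive (trans (sizes X (inF a S∈)) (sym len))) (≤-reflexive (trans (sizes X (inF a T∈)) (sym len)))

  -- Quantifying over sublists makes the bound survive every restriction of the family.
  Degree≤ : ℕ → List (Fin m) → List (Subset m) → Set
  Degree≤ b L ys = ∀ {f zs} → f ∉ˡ L → zs ⊆ˡ ys → Above (f ∷ L) zs → length zs ≤ b

  cover-bound : ∀ {L ys b} (C : List (Fin m)) → Above L ys →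
    (∀ {S} → S ∈ˡ ys → ∃ λ f → f ∈ˡ C × f ∈ S × f ∉ˡ L) → Degree≤ b L ys → length ys ≤ length C * b
  cover-bound {L} {ys} {b} C a cov deg = union-bound′ P? C ys cov small
    where
    P? : ∀ f → Decidable (λ S → f ∈ S × f ∉ˡ L)
    P? f S = (f ∈? S) ×-dec ¬? (f ∈ˡ? L)
    small : ∀ {f} → f ∈ˡ C → length (filter (P? f) ys) ≤ b
    small {f} _ = bound (f ∈ˡ? L)
      where
      a′ = above-filter (P? f) a
      bound : Dec (f ∈ˡ L) → length (filter (P? f) ys) ≤ b
      bound (no f∉) = deg f∉ (proj₁ ∘ ∈-filter⁻ (P? f)) (above (distinct a′) (inF a′)
                    (λ S∈ → ∷-⊑ (proj₁ (proj₂ (∈-filter⁻ (P? f) {xs = ys} S∈))) (kernel a′ S∈)))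
      bound (yes f∈) with filter (P? f) ys in eq
      ... | [] = z≤n
      ... | S ∷ _ = contradiction f∈ (proj₂ (proj₂ (∈-filter⁻ (P? f) {xs = ys} (subst (S ∈ˡ_) (sym eq) (here refl)))))

  outside : ∀ {L S n} → Unique L → L ⊑ S → S ∈ˡ F X → length L + suc n ≡ t → ∃ λ f → f ∈ S × f ∉ˡ L
  outside {L} {S} u sub S∈ len with petal L S in eq | petal-size {S = S} u sub (trans (sizes X S∈) (sym len))
  ... | f ∷ _ | _ = f , ∈-petal⁻ {L = L} {S} (subst (f ∈ˡ_) (sym eq) (here refl))

  -- While L is smaller than t, each set above it has a vertex outside L, for which there are at
  -- most m choices; n such choices are made.
  extend : ∀ n {L ys b} → Unique L → Above L ys → length L + n ≤ t →
    (∀ {L′ zs} → Unique L′ → L ⊆ˡ L′ → length L′ ≡ n + length L → Above L′ zs → length zs ≤ b) → length ys ≤ m ^ n * b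
  extend zero {b = b} u a le bd = ≤-trans (bd u id refl a) (≤-reflexive (sym (+-identityʳ b)))
  extend (suc n) {L} {ys} {b} u a le bd = ≤-trans
    (cover-bound (allFin m) a
      (λ S∈ → let (f , f∈ , f∉) = outside u (kernel a S∈) (inF a S∈) (sizeEq) in f , ∈-allFin f , f∈ , f∉)
      (λ f∉ _ a′ → extend n (∷-unique f∉ u) a′ (≤-trans (≤-reflexive (sym (+-suc (length L) n))) le)
        (λ u′ sub len → bd u′ (sub ∘ there) (trans len (+-suc n (length L))))))
    (≤-reflexive (trans (cong (_* (m ^ n * b)) (length-tabulate {n = m} id)) (sym (*-assoc m (m ^ n) b))))
    where
    sizeEq : length L + suc (t ∸ (length L + suc n) + n) ≡ t
    sizeEq = trans (cong (length L +_) (trans (sym (+-suc _ n)) (+-comm _ (suc n))))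
              (trans (sym (+-assoc (length L) (suc n) _)) (m+[n∸m]≡n le))

  -- Here S = L + c and T = L + d. A k-clique W of S dominates d. If it avoided c it would lie in L,
  -- hence in T, and together with d it would be a (k+1)-clique of T. So c lies in W.
  completions-adjacent : ∀ {L S T c d} → Unique L → suc (length L) ≡ t → S ∈ˡ F X → T ∈ˡ F X → S ≢ T →
    L ⊑ S → L ⊑ T → c ∈ S → c ∉ˡ L → d ∈ T → d ∉ˡ L → c ~ d
  completions-adjacent {L} {S} {T} {c} {d} u len S∈ T∈ S≢T L⊑S L⊑T c∈ c∉ d∈ d∉ with dominated S∈ d∉S
    where
    size≤ : ∀ {R} → R ∈ˡ F X → ∣ R ∣ ≤ suc (length L)
    size≤ R∈ = ≤-reflexive (trans (sizes X R∈) (sym len))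
    d∉S : d ∉ S
    d∉S d∈S = S≢T (subset-determined (∷-unique d∉ u) (∷-⊑ d∈S L⊑S) (∷-⊑ d∈ L⊑T) (size≤ S∈) (size≤ T∈))
  ... | W , cl , W⊑S , k≤W , d~W with c ∈ˡ? W
  ...   | yes c∈W = flip (H X) (d~W c∈W)
  ...   | no c∉W = contradiction (free-bound T∈ (clique-∷ (H X) d~W cl) (∷-⊑ d∈ W⊑T)) (<⇒≱ (s≤s k≤W))
    where
    W⊑T : W ⊑ T
    W⊑T w∈ with ⊑-tight (∷-unique c∉ u) (∷-⊑ c∈ L⊑S) (≤-reflexive (trans (sizes X S∈) (sym len))) (W⊑S w∈)
    ... | here refl = contradiction w∈ c∉W
    ... | there w∈L = L⊑T w∈L

  codegree : ∀ {L ys} → Unique L → Above L ys → suc (length L) ≡ t → length ys ≤ suc k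
  codegree {L} u a len
    with choose-allPairs {P = λ S c → S ∈ˡ F X × L ⊑ S × c ∈ S × c ∉ˡ L} {R = _~_}
      (λ S∈ → let (c , c∈ , c∉) = outside u (kernel a S∈) (inF a S∈) (trans (+-comm (length L) 1) len)
              in c , inF a S∈ , kernel a S∈ , c∈ , c∉)
      (AllPairs.map (λ neq _ _ (S∈ , L⊑S , c∈ , c∉) (T∈ , L⊑T , d∈ , d∉) →
                       completions-adjacent u len S∈ T∈ neq L⊑S L⊑T c∈ c∉ d∈ d∉) (distinct a))
  ... | cs , cl , len′ , _ = ≤-trans (≤-reflexive (sym len′)) (clique-bound cl)

  -- The `suc` counts one fixed member S₀. Every other member shares with it a k-clique, which is
  -- one of the t^k tuples from S₀.
  kernel-bound : ∀ {Q : Set} {b} →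
    (∀ {K ys} → Clique (H X) K → length K ≡ k → Above K ys → length ys ≤ b ⊎ Q) →
    length (F X) ≤ suc (t ^ k * b) ⊎ Q
  kernel-bound {Q} {b} bd with F X in eq | unique X
  ... | [] | _ = inj₁ z≤n
  ... | S₀ ∷ Fs | ≢S₀ ∷ uFs with union-bound {Q = Q} P? (tuples k (members S₀)) Fs cov small
    where
    Fs⊆ : Fs ⊆ˡ F X
    Fs⊆ T∈ = subst (_ ∈ˡ_) (sym eq) (there T∈)
    P? : ∀ K → Decidable (λ T → Clique (H X) K × All (_∈ T) K)
    P? K T = allPairs? (adj? (H X)) K ×-dec all? (_∈? T) K
    cov : ∀ {T} → T ∈ˡ Fs → ∃ λ K → K ∈ˡ tuples k (members S₀) × Clique (H X) K × All (_∈ T) K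
    cov {T} T∈ with HasClique⇒clique (H X) (pairwise X (subst (S₀ ∈ˡ_) (sym eq) (here refl)) (Fs⊆ T∈) (All.lookup ≢S₀ T∈))
    ... | K , cl , sub , len = K , ∈-tuples⁺ k len (∈-members⁺ ∘ proj₁ ∘ x∈p∩q⁻ S₀ T ∘ sub) , cl ,
                               All.tabulate (proj₂ ∘ x∈p∩q⁻ S₀ T ∘ sub)
    small : ∀ {K} → K ∈ˡ tuples k (members S₀) → length (filter (P? K) Fs) ≤ b ⊎ Q
    small {K} K∈ = bound (allPairs? (adj? (H X)) K)
      where
      bound : Dec (Clique (H X) K) → length (filter (P? K) Fs) ≤ b ⊎ Q
      bound (yes cl) = bd cl (∈-tuples⁻-length k K∈) (above (Unique.filter⁺ (P? K) uFs) (Fs⊆ ∘ proj₁ ∘ ∈-filter⁻ (P? K))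
                     (λ S∈ → All.lookup (proj₂ (proj₂ (∈-filter⁻ (P? K) {xs = Fs} S∈)))))
      -- Tuples that are not cliques are listed too, but no member is counted under them.
      bound (no ¬cl) with filter (P? K) Fs in eq′
      ... | [] = inj₁ z≤n
      ... | S ∷ _ = contradiction (proj₁ (proj₂ (∈-filter⁻ (P? K) {xs = Fs} (subst (S ∈ˡ_) (sym eq′) (here refl))))) ¬cl
  ... | inj₂ q = inj₂ q
  ... | inj₁ le = inj₁ (s≤s (≤-trans le (≤-reflexive (cong (_* b) (trans (length-tuples k (members S₀))
          (cong (_^ k) (trans (length-members S₀) (sizes X (subst (S₀ ∈ˡ_) (sym eq) (here refl))))))))))

  avoid : ∀ {L ys b} (C : List (Fin m)) → Above L ys → Degree≤ b L ys →
    length ys ≤ length C * b ⊎ (∃ λ S → S ∈ˡ ys × (∀ {x} → x ∈ S → x ∉ˡ L → x ∉ˡ C))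
  avoid {L} {ys} C a deg with any? (λ S → all? (λ x → ¬? (x ∈ˡ? C)) (petal L S)) ys
  ... | yes ex = let (S , S∈ , ok) = find ex in inj₂ (S , S∈ , λ x∈ x∉ → All.lookup ok (∈-petal⁺ x∈ x∉))
  ... | no ¬ex = inj₁ (cover-bound C a cov deg)
    where
    cov : ∀ {S} → S ∈ˡ ys → ∃ λ f → f ∈ˡ C × f ∈ S × f ∉ˡ L
    cov {S} S∈ with find (All.¬All⇒Any¬ (λ x → ¬? (x ∈ˡ? C)) (petal L S) (λ all → ¬ex (lose S∈ all)))
    ... | f , f∈ , ¬¬f = f , decidable-stable (f ∈ˡ? C) ¬¬f , ∈-petal⁻ {L = L} {S} f∈

  MeetIn : List (Fin m) → Subset m → Subset m → Set
  MeetIn L S T = ∀ {x} → x ∈ S → x ∈ T → x ∈ˡ L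

  -- Greedy: s petals cover at most s * d vertices outside L, and by the degree bound few members
  -- meet these. Any other member continues the sunflower.
  sunflower : ∀ {L ys b d} s → Unique L → length L + d ≡ t → Above L ys → Degree≤ b L ys →
    length ys ≤ s * d * b ⊎ (∃ λ zs → zs ⊆ˡ ys × length zs ≡ s × AllPairs (MeetIn L) zs)
  sunflower zero u len a deg = inj₂ ([] , (λ ()) , refl , [])
  sunflower {L} {ys} {b} {d} (suc s) u len a deg with sunflower s u len a deg
  ... | inj₁ le = inj₁ (≤-trans le (*-monoˡ-≤ b (m≤n+m (s * d) d)))
  ... | inj₂ (zs , sub , refl , ap) with avoid (concat (map (petal L) zs)) a deg
  ...   | inj₁ le = inj₁ (≤-trans le (*-monoˡ-≤ b (≤-trans (concat≤ zs sub) (m≤n+m _ d))))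
    where
    concat≤ : ∀ zs → zs ⊆ˡ ys → length (concat (map (petal L) zs)) ≤ length zs * d
    concat≤ [] _ = z≤n
    concat≤ (S ∷ zs) sub = ≤-trans (≤-reflexive (length-++ (petal L S)))
      (+-mono-≤ (≤-reflexive (petal-size u (kernel a S∈) (trans (sizes X (inF a S∈)) (sym len)))) (concat≤ zs (sub ∘ there)))
      where S∈ = sub (here refl)
  ...   | inj₂ (S , S∈ , fresh) = inj₂ (S ∷ zs , (λ { (here refl) → S∈ ; (there T∈) → sub T∈ }) , refl , All.tabulate meet ∷ ap)
    where
    meet : ∀ {T} → T ∈ˡ zs → MeetIn L S T
    meet {T} T∈ {x} x∈S x∈T with x ∈ˡ? L
    ... | yes x∈L = x∈L
    ... | no x∉L = contradiction (∈-concat⁺′ (∈-petal⁺ x∈T x∉L) (∈-map⁺ (petal L) T∈)) (fresh x∈S x∉L)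

  -- Suppose z in K is missing from T. The k-clique shared by T and a petal set S avoids z, so it
  -- does not fit into K and has a vertex of S outside K. These vertices differ for different S,
  -- which gives T more than t vertices.
  big-sunflower-kernel : ∀ {K zs} → Clique (H X) K → length K ≡ k → zs ⊆ˡ F X → (∀ {S} → S ∈ˡ zs → K ⊑ S) →
    AllPairs (MeetIn K) zs → t < length zs → ∀ {T} → T ∈ˡ F X → K ⊑ T
  big-sunflower-kernel {K} {zs} cl len sub K⊑ ap big {T} T∈ {z} z∈K with z ∈? T
  ... | yes z∈T = z∈T
  ... | no z∉T with choose-allPairs {P = λ S w → w ∈ S × w ∉ˡ K × w ∈ T} {R = _≢_} hit
                      (AllPairs.map (λ meet _ _ (w∈S , w∉K , _) (v∈S , _) → λ { refl → w∉K (meet w∈S v∈S) }) ap)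
    where
    hit : ∀ {S} → S ∈ˡ zs → ∃ λ w → w ∈ S × w ∉ˡ K × w ∈ T
    hit {S} S∈ with HasClique⇒clique (H X) (pairwise X (sub S∈) T∈ (λ { refl → z∉T (K⊑ S∈ z∈K) }))
    ... | W , clW , W⊑ , lenW with all? (_∈ˡ? K) W
    ...   | no ¬all = let (w , w∈ , w∉K) = find (All.¬All⇒Any¬ (_∈ˡ? K) W ¬all)
                          (w∈S , w∈T) = x∈p∩q⁻ S T (W⊑ w∈)
                      in w , w∈S , w∉K , w∈T
    ...   | yes all = contradiction (unique-length-≤ (∷-unique z∉W (clique-unique (H X) clW)) λ { (here refl) → z∈K ; (there w∈) → All.lookup all w∈ })
                        (<⇒≱ (s≤s (≤-reflexive (trans len (sym lenW)))))
      where z∉W = λ z∈W → z∉T (proj₂ (x∈p∩q⁻ S T (W⊑ z∈W)))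
  ...   | ws , uws , lenws , orig = contradiction
            (unique-⊑-length {S = T} uws (λ w∈ → let (_ , _ , _ , _ , w∈T) = orig w∈ in w∈T))
            (<⇒≱ (≤-trans (s≤s (≤-reflexive (sizes X T∈))) (≤-trans big (≤-reflexive (sym lenws)))))

-- Triangle-free links

module Link {k t m : ℕ} (X : System (2 + k) t m) where
  open Facts X

  -- Domination is asserted only for vertices of other petals. A vertex joined to all of the kernel
  -- may be dominated by the kernel alone and need not have a neighbour in the petal.
  record TriangleFreeLink (L : List (Fin m)) (ys : List (Subset m)) : Set where
    field
      fresh       : Unique L
      sets        : Above L ys
      independent : ∀ {S x y} → S ∈ˡ ys → x ∈ S → x ∉ˡ L → y ∈ S → y ∉ˡ L → ¬ x ~ y
      dominating  : ∀ {S T y} → S ∈ˡ ys → T ∈ˡ ys → y ∈ T → y ∉ˡ L → y ∉ S → ∃ λ x → x ∈ S × x ∉ˡ L × x ~ y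
      no-triangle : ∀ {x y z} → x ∉ˡ L → y ∉ˡ L → z ∉ˡ L → x ~ y → y ~ z → x ~ z → ⊥

  module _ {L : List (Fin m)} {ys : List (Subset m)} (link : TriangleFreeLink L ys) where
    open TriangleFreeLink link

    Edge : Fin m → Fin m → Set
    Edge x y = x ~ y × x ∉ˡ L × y ∉ˡ L

    rev : ∀ {x y} → Edge x y → Edge y x
    rev (e , x∉ , y∉) = flip (H X) e , y∉ , x∉

    triangle : ∀ {x y z} → Edge x y → Edge y z → Edge x z → ⊥
    triangle (e , x∉ , y∉) (f , _ , z∉) (g , _) = no-triangle x∉ y∉ z∉ e f g

    Good : Fin m → Set
    Good v = ∃ λ S → S ∈ˡ ys × v ∈ S × v ∉ˡ L

    record Triple (a b c : Fin m) : Set where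
      constructor triple
      field
        {set} : Subset m
        set∈  : set ∈ˡ ys
        a∈    : a ∈ set × a ∉ˡ L
        b∈    : b ∈ set × b ∉ˡ L
        c∈    : c ∈ set × c ∉ˡ L
        a≢b   : a ≢ b
        a≢c   : a ≢ c
        b≢c   : b ≢ c
        only  : ∀ {x} → x ∈ set → x ∉ˡ L → x ≡ a ⊎ x ≡ b ⊎ x ≡ c
    open Triple

    swap : ∀ {a b c} → Triple a b c → Triple a c b
    swap (triple S∈ a∈ b∈ c∈ a≢b a≢c b≢c only) = triple S∈ a∈ c∈ b∈ a≢c a≢b (≢-sym b≢c) λ x∈ x∉ → case only x∈ x∉ of λ where
      (inj₁ p) → inj₁ p
      (inj₂ (inj₁ p)) → inj₂ (inj₂ p)
      (inj₂ (inj₂ p)) → inj₂ (inj₁ p)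

    rotate : ∀ {a b c} → Triple a b c → Triple b c a
    rotate (triple S∈ a∈ b∈ c∈ a≢b a≢c b≢c only) = triple S∈ b∈ c∈ a∈ b≢c (≢-sym a≢b) (≢-sym a≢c) λ x∈ x∉ → case only x∈ x∉ of λ where
      (inj₁ p) → inj₂ (inj₂ p)
      (inj₂ (inj₁ p)) → inj₁ p
      (inj₂ (inj₂ p)) → inj₂ (inj₁ p)

    good : ∀ {a b c} → Triple a b c → Good a
    good T = _ , set∈ T , a∈ T

    apart : ∀ {a b c} → Triple a b c → ¬ Edge a b
    apart T (e , _) = independent (set∈ T) (proj₁ (a∈ T)) (proj₂ (a∈ T)) (proj₁ (b∈ T)) (proj₂ (b∈ T)) e

    hit : ∀ {a b c v} → Triple a b c → Good v → v ≢ a → v ≢ b → v ≢ c → Edge a v ⊎ Edge b v ⊎ Edge c v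
    hit {a} {b} {c} {v} T (S , S∈ , v∈ , v∉) v≢a v≢b v≢c = classify (dominating (set∈ T) S∈ v∈ v∉ v∉T)
      where
      v∉T : v ∉ set T
      v∉T v∈T with only T v∈T v∉
      ... | inj₁ p = v≢a p
      ... | inj₂ (inj₁ p) = v≢b p
      ... | inj₂ (inj₂ p) = v≢c p
      classify : (∃ λ x → x ∈ set T × x ∉ˡ L × x ~ v) → Edge a v ⊎ Edge b v ⊎ Edge c v
      classify (x , x∈ , x∉ , e) with only T x∈ x∉
      ... | inj₁ refl = inj₁ (e , x∉ , v∉)
      ... | inj₂ (inj₁ refl) = inj₂ (inj₁ (e , x∉ , v∉))
      ... | inj₂ (inj₂ refl) = inj₂ (inj₂ (e , x∉ , v∉))

    hit′ : ∀ {a b c v} → Triple a b c → Good v → v ≢ a → v ≢ b → v ≢ c → ¬ Edge a v → Edge b v ⊎ Edge c v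
    hit′ T g p q r ¬e with hit T g p q r
    ... | inj₁ e = contradiction e ¬e
    ... | inj₂ e = e

    containing : Fin m → List (Subset m)
    containing a = filter (a ∈?_) ys

    -- The longest list to be avoided later consists of b, c, one vertex from each of the two petals
    -- pointing towards a, and b₁, c₁: six vertices. For petals of size three, at most k + 1 sets
    -- contain `a` and a given further vertex, so some petal through a rich `a` avoids all six.
    Rich : Fin m → Set
    Rich a = ¬ (length (containing a) ≤ 6 * suc k)

    above-containing : ∀ {a} → Above (a ∷ L) (containing a)
    above-containing {a} = above (distinct a′) (inF a′) λ S∈ → ∷-⊑ (proj₂ (∈-filter⁻ (a ∈?_) {xs = ys} S∈)) (kernel a′ S∈)
      where a′ = above-filter (a ∈?_) sets

    -- Petals of size three: one vertex lies in few petals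

    module Triples (len : length L + 3 ≡ t) where

      triple-at : ∀ {a S} → a ∈ S → a ∉ˡ L → S ∈ˡ ys → ∃₂ λ y z → Triple a y z × y ∈ S × z ∈ S
      triple-at {a} {S} a∈S a∉L S∈ = build (petal (a ∷ L) S) refl
        (petal-size {L = a ∷ L} {S} {2} (∷-unique a∉L fresh) (∷-⊑ a∈S (kernel sets S∈))
               (trans (sizes X (inF sets S∈)) (trans (sym len) (+-suc (length L) 2))))
        where
        build : ∀ ps → ps ≡ petal (a ∷ L) S → length ps ≡ 2 → ∃₂ λ y z → Triple a y z × y ∈ S × z ∈ S
        build (y ∷ z ∷ []) eq _ = y , z , triple S∈ (a∈S , a∉L) (proj₁ y∈ , proj₂ y∈ ∘ there) (proj₁ z∈ , proj₂ z∈ ∘ there)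
          (proj₂ y∈ ∘ here ∘ sym) (proj₂ z∈ ∘ here ∘ sym) (y≢z (subst Unique (sym eq) (petal-unique (a ∷ L) S))) only′ , proj₁ y∈ , proj₁ z∈
          where
          y≢z : Unique (y ∷ z ∷ []) → y ≢ z
          y≢z ((neq ∷ _) ∷ _) = neq
          y∈ = ∈-petal⁻ {L = a ∷ L} {S} (subst (y ∈ˡ_) eq (here refl))
          z∈ = ∈-petal⁻ {L = a ∷ L} {S} (subst (z ∈ˡ_) eq (there (here refl)))
          only′ : ∀ {x} → x ∈ S → x ∉ˡ L → x ≡ a ⊎ x ≡ y ⊎ x ≡ z
          only′ {x} x∈ x∉ with x Fin.≟ a
          ... | yes p = inj₁ p
          ... | no x≢a with subst (x ∈ˡ_) (sym eq) (∈-petal⁺ x∈ (λ x∈aL → x∉ (∈∷⁻ x∈aL x≢a)))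
          ...   | here p = inj₂ (inj₁ p)
          ...   | there (here p) = inj₂ (inj₂ p)

      rich-avoid : ∀ {a} → Rich a → a ∉ˡ L → ∀ C → length C ≤ 6 → ∃₂ λ y z → Triple a y z × y ∉ˡ C × z ∉ˡ C
      rich-avoid {a} rich a∉L C C≤6 = extract (avoid {L = a ∷ L} {b = suc k} C above-containing
        (λ f∉ _ a′ → codegree (∷-unique f∉ (∷-unique a∉L fresh)) a′ (trans (+-comm 3 (length L)) len)))
        where
        extract : length (containing a) ≤ length C * suc k ⊎ (∃ λ S → S ∈ˡ containing a × (∀ {x} → x ∈ S → x ∉ˡ a ∷ L → x ∉ˡ C)) → _
        extract (inj₁ le) = contradiction (≤-trans le (*-monoˡ-≤ (suc k) C≤6)) rich
        extract (inj₂ (S , S∈ , avoids)) =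
          let (S∈ys , a∈S) = ∈-filter⁻ (a ∈?_) {xs = ys} S∈
              (y , z , T , y∈ , z∈) = triple-at a∈S a∉L S∈ys
              y∉ = λ { (here p) → a≢b T (sym p) ; (there y∈L) → proj₂ (b∈ T) y∈L }
              z∉ = λ { (here p) → a≢c T (sym p) ; (there z∈L) → proj₂ (c∈ T) z∈L }
          in y , z , T , avoids y∈ y∉ , avoids z∈ z∉

      record Toward (a b c : Fin m) : Set where
        field
          {y z} : Fin m
          tri   : Triple b y z
          y-a   : Edge y a
          z∤a   : ¬ Edge z a
          z-c   : Edge z c
          z≢a   : z ≢ a

      -- In a petal b y z some vertex sees a, and it is not b; say it is y. If z saw a as well, take
      -- a second petal through b with a vertex y′ that sees a: y′ is dominated by y or z, and this
      -- closes a triangle with a. So z does not see a, nor b, and must be dominated by c.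
      toward : ∀ {a b c} → Triple a b c → Rich b → Toward a b c
      toward {a} {b} {c} T rich =
        let b∉L = proj₂ (b∈ T)
            (y , z , U , y∉ , z∉) = rich-avoid rich b∉L (a ∷ c ∷ []) (s≤s (s≤s z≤n))
            (y′ , z′ , U′ , y′∉ , z′∉) = rich-avoid rich b∉L (a ∷ y ∷ z ∷ []) (s≤s (s≤s (s≤s z≤n)))
        in orient U y∉ z∉ (reach U (∉₀ y∉) (∉₀ z∉)) U′ y′∉ z′∉ (reach U′ (∉₀ y′∉) (∉₀ z′∉))
        where
        reach : ∀ {y z} → Triple b y z → y ≢ a → z ≢ a → Edge y a ⊎ Edge z a
        reach U y≢a z≢a = hit′ U (good T) (a≢b T) (≢-sym y≢a) (≢-sym z≢a) (apart T ∘ rev)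
        blocked : ∀ {y z y′ z′} → Triple b y z → Edge y a → Triple b y′ z′ → y′ ≢ y → y′ ≢ z → Edge y′ a → ¬ Edge z a
        blocked U ya U′ y′≢y y′≢z y′a za with hit′ U (good (rotate U′)) (≢-sym (a≢b U′)) y′≢y y′≢z (apart U′)
        ... | inj₁ yy′ = triangle yy′ y′a ya
        ... | inj₂ zy′ = triangle zy′ y′a za
        close : ∀ {y z} → Triple b y z → z ∉ˡ a ∷ c ∷ [] → Edge y a → ¬ Edge z a → Toward a b c
        close U z∉ ya ¬za = record { tri = U ; y-a = ya ; z∤a = ¬za ; z≢a = ∉₀ z∉ ; z-c = zc }
          where
          zc = case hit T (good (rotate (swap U))) (∉₀ z∉) (≢-sym (a≢c U)) (∉₁ z∉) of λ where
            (inj₁ az) → contradiction (rev az) ¬za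
            (inj₂ (inj₁ bz)) → contradiction bz (apart (swap U))
            (inj₂ (inj₂ cz)) → rev cz
        orient : ∀ {y z y′ z′} → Triple b y z → y ∉ˡ a ∷ c ∷ [] → z ∉ˡ a ∷ c ∷ [] → Edge y a ⊎ Edge z a →
          Triple b y′ z′ → y′ ∉ˡ a ∷ y ∷ z ∷ [] → z′ ∉ˡ a ∷ y ∷ z ∷ [] → Edge y′ a ⊎ Edge z′ a → Toward a b c
        orient U y∉ z∉ (inj₁ ya) U′ y′∉ z′∉ (inj₁ y′a) = close U z∉ ya (blocked U ya U′ (∉₁ y′∉) (∉₂ y′∉) y′a)
        orient U y∉ z∉ (inj₁ ya) U′ y′∉ z′∉ (inj₂ z′a) = close U z∉ ya (blocked U ya (swap U′) (∉₁ z′∉) (∉₂ z′∉) z′a)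
        orient U y∉ z∉ (inj₂ za) U′ y′∉ z′∉ (inj₁ y′a) = close (swap U) y∉ za (blocked (swap U) za U′ (∉₂ y′∉) (∉₁ y′∉) y′a)
        orient U y∉ z∉ (inj₂ za) U′ y′∉ z′∉ (inj₂ z′a) = close (swap U) y∉ za (blocked (swap U) za (swap U′) (∉₂ z′∉) (∉₁ z′∉) z′a)

      record Matched (a b c : Fin m) (C : List (Fin m)) : Set where
        field
          {b′ c′} : Fin m
          tri     : Triple a b′ c′
          b-c′    : Edge b c′
          c-b′    : Edge c b′
          b′∉     : b′ ∉ˡ b ∷ c ∷ C
          c′∉     : c′ ∉ˡ b ∷ c ∷ C

      -- The common vertex a sees none of b, c, u, v, so domination in both directions leaves no
      -- isolated vertex in the bipartite graph between {b, c} and {u, v}. Such a graph has a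
      -- perfect matching, and u, v are named after it.
      matched : ∀ {a b c u v C} → Triple a b c → Triple a u v → u ∉ˡ b ∷ c ∷ C → v ∉ˡ b ∷ c ∷ C → Matched a b c C
      matched {a} {b} {c} {u} {v} {C} T U u∉ v∉ = cases
        (hit′ U (good (rotate T)) (≢-sym (a≢b T)) (≢-sym (∉₀ u∉)) (≢-sym (∉₀ v∉)) (apart T))
        (hit′ U (good (rotate (swap T))) (≢-sym (a≢c T)) (≢-sym (∉₁ u∉)) (≢-sym (∉₁ v∉)) (apart (swap T)))
        (hit′ T (good (rotate U)) (≢-sym (a≢b U)) (∉₀ u∉) (∉₁ u∉) (apart U))
        (hit′ T (good (rotate (swap U))) (≢-sym (a≢c U)) (∉₀ v∉) (∉₁ v∉) (apart (swap U)))
        where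
        straight : Edge b v → Edge c u → Matched a b c C
        straight bv cu = record { tri = U ; b-c′ = bv ; c-b′ = cu ; b′∉ = u∉ ; c′∉ = v∉ }
        crossed : Edge b u → Edge c v → Matched a b c C
        crossed bu cv = record { tri = swap U ; b-c′ = bu ; c-b′ = cv ; b′∉ = v∉ ; c′∉ = u∉ }
        cases : Edge u b ⊎ Edge v b → Edge u c ⊎ Edge v c → Edge b u ⊎ Edge c u → Edge b v ⊎ Edge c v → Matched a b c C
        cases (inj₁ ub) (inj₂ vc) _ _ = crossed (rev ub) (rev vc)
        cases (inj₂ vb) (inj₁ uc) _ _ = straight (rev vb) (rev uc)
        cases (inj₁ ub) (inj₁ uc) _ (inj₁ bv) = straight bv (rev uc)
        cases (inj₁ ub) (inj₁ uc) _ (inj₂ cv) = crossed (rev ub) cv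
        cases (inj₂ vb) (inj₂ vc) (inj₁ bu) _ = crossed bu (rev vc)
        cases (inj₂ vb) (inj₂ vc) (inj₂ cu) _ = straight (rev vb) cu

      -- T₁ = b y z and T₂ = c w x point towards a through y and w, and
      -- a b₁ c₁, a b₂ c₂ is a crown with a b c; then w and z are adjacent,
      -- and no vertex of a b₂ c₂ can dominate z.
      not-all-rich : ∀ {a b c} → Triple a b c → Rich a → Rich b → Rich c → ⊥
      not-all-rich {a} {b} {c} T rich-a rich-b rich-c = first (toward T rich-b) (toward (swap T) rich-c)
        where
        a∉L = proj₂ (a∈ T)
        -- The avoided lists keep z and x, the far vertices of the two petals, out of both matched
        -- petals, and keep the matched petals apart from each other; so domination can be applied
        -- to these vertices.
        finish : (B : Toward a b c) (C : Toward a c b)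
          (M₁ : Matched a b c (Toward.z B ∷ Toward.z C ∷ []))
          (M₂ : Matched a b c (Toward.z B ∷ Toward.z C ∷ Matched.b′ M₁ ∷ Matched.c′ M₁ ∷ [])) → ⊥
        finish B C M₁ M₂ = z-undominated
          where
          open Toward B using (y; z) renaming (tri to T₁; y-a to ya; z∤a to ¬za; z-c to zc; z≢a to z≢a)
          open Toward C renaming (y to w; z to x; tri to T₂; y-a to wa; z-c to xb) using ()
          open Matched M₁ renaming (b′ to b₁; c′ to c₁; tri to U₁; b-c′ to bc₁; c-b′ to cb₁; b′∉ to b₁∉; c′∉ to c₁∉) using ()
          open Matched M₂ renaming (b′ to b₂; c′ to c₂; tri to U₂; b-c′ to bc₂; c-b′ to cb₂; b′∉ to b₂∉; c′∉ to c₂∉) using ()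
          b₁c₂ : Edge b₁ c₂
          b₁c₂ with hit′ U₂ (good (rotate U₁)) (≢-sym (a≢b U₁))
                      (λ p → b₂∉ (there (there (there (there (here (sym p)))))))
                      (λ p → c₂∉ (there (there (there (there (here (sym p))))))) (apart U₁)
          ... | inj₁ b₂b₁ = ⊥-elim (triangle cb₂ b₂b₁ cb₁)
          ... | inj₂ e = rev e
          ¬bb₁ : ¬ Edge b b₁
          ¬bb₁ e = triangle e b₁c₂ bc₂
          ¬cc₂ : ¬ Edge c c₂
          ¬cc₂ e = triangle cb₁ b₁c₂ e
          yb₁ : Edge y b₁
          yb₁ with hit′ T₁ (good (rotate U₁)) (∉₀ b₁∉) (λ { refl → apart U₁ (rev ya) }) (∉₂ b₁∉) ¬bb₁
          ... | inj₁ e = e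
          ... | inj₂ zb₁ = ⊥-elim (triangle zc cb₁ zb₁)
          wc₂ : Edge w c₂
          wc₂ with hit′ T₂ (good (rotate (swap U₂))) (∉₁ c₂∉) (λ { refl → apart (swap U₂) (rev wa) })
                     (λ p → c₂∉ (there (there (there (here p))))) ¬cc₂
          ... | inj₁ e = e
          ... | inj₂ xc₂ = ⊥-elim (triangle xb bc₂ xc₂)
          zw : Edge z w
          zw with hit T₁ (good (rotate T₂)) (λ { refl → apart T (rev wa) }) (λ { refl → triangle yb₁ b₁c₂ wc₂ }) (λ { refl → apart T₂ (rev zc) })
          ... | inj₁ bw = ⊥-elim (triangle bw wc₂ bc₂)
          ... | inj₂ (inj₁ yw) = ⊥-elim (triangle yw wa ya)
          ... | inj₂ (inj₂ e) = e
          z-undominated : ⊥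
          z-undominated with hit U₂ (good (rotate (swap T₁))) z≢a (≢-sym (∉₂ b₂∉)) (≢-sym (∉₂ c₂∉))
          ... | inj₁ az = ¬za (rev az)
          ... | inj₂ (inj₁ b₂z) = triangle zc cb₂ (rev b₂z)
          ... | inj₂ (inj₂ c₂z) = triangle zw wc₂ (rev c₂z)
        next : ∀ C → length C ≤ 4 → Matched a b c C
        next C C≤4 = let (u , v , U , u∉ , v∉) = rich-avoid rich-a a∉L (b ∷ c ∷ C) (s≤s (s≤s C≤4)) in matched T U u∉ v∉
        first : Toward a b c → Toward a c b → ⊥
        first B C = finish B C M₁ (next _ (s≤s (s≤s (s≤s (s≤s z≤n)))))
          where M₁ = next (Toward.z B ∷ Toward.z C ∷ []) (s≤s (s≤s z≤n))

      link-linear : length ys ≤ m * (6 * suc k)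
      link-linear = ≤-trans (union-bound′ P? (allFin m) ys poor small) (≤-reflexive (cong (_* (6 * suc k)) (length-tabulate {n = m} id)))
        where
        deg≤? = λ a → length (containing a) ≤? 6 * suc k
        P? : ∀ a → Decidable (λ S → a ∈ S × length (containing a) ≤ 6 * suc k)
        P? a S = (a ∈? S) ×-dec deg≤? a
        small : ∀ {a} → a ∈ˡ allFin m → length (filter (P? a) ys) ≤ 6 * suc k
        small {a} _ = bound (deg≤? a)
          where
          bound : Dec (length (containing a) ≤ 6 * suc k) → length (filter (P? a) ys) ≤ 6 * suc k
          bound (yes le) = ≤-trans (unique-length-≤ (Unique.filter⁺ (P? a) (distinct sets))
            (λ S∈ → let (S∈ys , a∈S , _) = ∈-filter⁻ (P? a) {xs = ys} S∈ in ∈-filter⁺ (a ∈?_) S∈ys a∈S)) le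
          bound (no ¬le) with filter (P? a) ys in eq
          ... | [] = z≤n
          ... | S ∷ _ = contradiction (proj₂ (proj₂ (∈-filter⁻ (P? a) {xs = ys} (subst (S ∈ˡ_) (sym eq) (here refl))))) ¬le
        poor : ∀ {S} → S ∈ˡ ys → ∃ λ a → a ∈ˡ allFin m × a ∈ S × length (containing a) ≤ 6 * suc k
        poor {S} S∈ =
          let (a , a∈S , a∉L) = outside fresh (kernel sets S∈) (inF sets S∈) len
              (b , c , T , b∈S , c∈S) = triple-at a∈S a∉L S∈
          in find-poor a∈S b∈S c∈S T (deg≤? a) (deg≤? b) (deg≤? c)
          where
          find-poor : ∀ {a b c} → a ∈ S → b ∈ S → c ∈ S → Triple a b c →
            Dec (length (containing a) ≤ 6 * suc k) → Dec (length (containing b) ≤ 6 * suc k) → Dec (length (containing c) ≤ 6 * suc k) →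
            ∃ λ a → a ∈ˡ allFin m × a ∈ S × length (containing a) ≤ 6 * suc k
          find-poor {a} a∈S _ _ T (yes le) _ _ = a , ∈-allFin a , a∈S , le
          find-poor {b = b} _ b∈S _ T _ (yes le) _ = b , ∈-allFin b , b∈S , le
          find-poor {c = c} _ _ c∈S T _ _ (yes le) = c , ∈-allFin c , c∈S , le
          find-poor _ _ _ T (no ra) (no rb) (no rc) = ⊥-elim (not-all-rich T ra rb rc)

    -- Petals of size two: disjointness

    record Pair (a b : Fin m) : Set where
      constructor pair
      field
        {set} : Subset m
        set∈  : set ∈ˡ ys
        a∈    : a ∈ set × a ∉ˡ L
        b∈    : b ∈ set × b ∉ˡ L
        a≢b   : a ≢ b
        only  : ∀ {x} → x ∈ set → x ∉ˡ L → x ≡ a ⊎ x ≡ b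

    module Pairs (len : length L + 2 ≡ t) where
      open Pair

      exchange : ∀ {a b} → Pair a b → Pair b a
      exchange (pair S∈ a∈ b∈ a≢b only) = pair S∈ b∈ a∈ (≢-sym a≢b) λ x∈ x∉ → case only x∈ x∉ of λ where
        (inj₁ p) → inj₂ p
        (inj₂ p) → inj₁ p

      pair-at : ∀ {a S} → a ∈ S → a ∉ˡ L → S ∈ˡ ys → ∃ λ b → Σ (Pair a b) λ P → set P ≡ S
      pair-at {a} {S} a∈S a∉L S∈ = build (petal (a ∷ L) S) refl
        (petal-size {L = a ∷ L} {S} {1} (∷-unique a∉L fresh) (∷-⊑ a∈S (kernel sets S∈))
               (trans (sizes X (inF sets S∈)) (trans (sym len) (+-suc (length L) 1))))
        where
        build : ∀ ps → ps ≡ petal (a ∷ L) S → length ps ≡ 1 → ∃ λ b → Σ (Pair a b) λ P → set P ≡ S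
        build (y ∷ []) eq _ = y , pair S∈ (a∈S , a∉L) (proj₁ y∈ , proj₂ y∈ ∘ there) (≢-sym (∉₀ (proj₂ y∈))) only′ , refl
          where
          y∈ = ∈-petal⁻ {L = a ∷ L} {S} (subst (y ∈ˡ_) eq (here refl))
          only′ : ∀ {x} → x ∈ S → x ∉ˡ L → x ≡ a ⊎ x ≡ y
          only′ {x} x∈ x∉ with x Fin.≟ a
          ... | yes p = inj₁ p
          ... | no x≢a with subst (x ∈ˡ_) (sym eq) (∈-petal⁺ x∈ (λ x∈aL → x∉ (∈∷⁻ x∈aL x≢a)))
          ...   | here p = inj₂ p

      strike : ∀ {a b c d} → Pair a b → Pair c d → c ≢ a → c ≢ b → Edge a c ⊎ Edge b c
      strike {a} {b} {c} P R c≢a c≢b = classify (dominating (set∈ P) (set∈ R) (proj₁ (a∈ R)) (proj₂ (a∈ R)) c∉P)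
        where
        c∉P : c ∉ set P
        c∉P c∈P with only P c∈P (proj₂ (a∈ R))
        ... | inj₁ p = c≢a p
        ... | inj₂ p = c≢b p
        classify : (∃ λ x → x ∈ set P × x ∉ˡ L × x ~ c) → Edge a c ⊎ Edge b c
        classify (x , x∈ , x∉ , e) with only P x∈ x∉
        ... | inj₁ refl = inj₁ (e , x∉ , proj₂ (a∈ R))
        ... | inj₂ refl = inj₂ (e , x∉ , proj₂ (a∈ R))

      same-set : ∀ {a b} (P R : Pair a b) → set P ≡ set R
      same-set {a} {b} P R = ⊆-antisym (incl P R) (incl R P)
        where
        incl : ∀ (P R : Pair a b) {x} → x ∈ set P → x ∈ set R
        incl P R {x} x∈ with x ∈ˡ? L
        ... | yes x∈L = kernel sets (set∈ R) x∈L
        ... | no x∉L with only P x∈ x∉L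
        ...   | inj₁ refl = proj₁ (a∈ R)
        ...   | inj₂ refl = proj₁ (b∈ R)

      record Fan (a b b′ : Fin m) (C : List (Fin m)) : Set where
        field
          {c d} : Fin m
          P     : Pair c d
          b-c   : Edge b c
          a-c   : Edge a c
          a-d   : Edge a d
          c∉    : c ∉ˡ a ∷ b ∷ b′ ∷ C
          d∉    : d ∉ˡ a ∷ b ∷ b′ ∷ C

      -- Let c be the vertex of the new pair that sees b. Since b and b′ are adjacent, c does not
      -- see b′, so d does, and then d does not see b. Now {a, b′} dominates c and {a, b} dominates
      -- d, both through a.
      fan : ∀ {a b b′ c d C} → Pair a b → Pair a b′ → Edge b b′ → Pair c d →
        c ∉ˡ a ∷ b ∷ b′ ∷ C → d ∉ˡ a ∷ b ∷ b′ ∷ C → Fan a b b′ C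
      fan {a} {b} {b′} {C = C} P P′ bb′ R c∉ d∉ = orient (strike R (exchange P) (≢-sym (∉₁ c∉)) (≢-sym (∉₁ d∉)))
        where
        build : ∀ {c d} → Pair c d → c ∉ˡ a ∷ b ∷ b′ ∷ C → d ∉ˡ a ∷ b ∷ b′ ∷ C → Edge b c → Fan a b b′ C
        build {c} {d} R c∉ d∉ bc = record { P = R ; b-c = bc ; a-c = ac ; a-d = ad ; c∉ = c∉ ; d∉ = d∉ }
          where
          db′ : Edge d b′
          db′ with strike R (exchange P′) (≢-sym (∉₂ c∉)) (≢-sym (∉₂ d∉))
          ... | inj₁ cb′ = ⊥-elim (triangle bc cb′ bb′)
          ... | inj₂ e = e
          ac : Edge a c
          ac with strike P′ R (∉₀ c∉) (∉₂ c∉)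
          ... | inj₁ e = e
          ... | inj₂ b′c = ⊥-elim (triangle bb′ b′c bc)
          ad : Edge a d
          ad with strike P (exchange R) (∉₀ d∉) (∉₁ d∉)
          ... | inj₁ e = e
          ... | inj₂ bd = ⊥-elim (triangle bd db′ bb′)
        orient : Edge _ b ⊎ Edge _ b → Fan a b b′ C
        orient (inj₁ cb) = build R c∉ d∉ (rev cb)
        orient (inj₂ db) = build (exchange R) d∉ c∉ (rev db)

      fresh-pair : ¬ (length ys ≤ 5 * suc k) → ∀ C → length C ≤ 5 → ∃₂ λ c d → Pair c d × c ∉ˡ C × d ∉ˡ C
      fresh-pair many C C≤5 = extract (avoid {b = suc k} C sets
        (λ f∉ _ a′ → codegree (∷-unique f∉ fresh) a′ (trans (+-comm 2 (length L)) len)))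
        where
        extract : length ys ≤ length C * suc k ⊎ (∃ λ S → S ∈ˡ ys × (∀ {x} → x ∈ S → x ∉ˡ L → x ∉ˡ C)) →
          ∃₂ λ c d → Pair c d × c ∉ˡ C × d ∉ˡ C
        extract (inj₁ le) = contradiction (≤-trans le (*-monoˡ-≤ (suc k) C≤5)) many
        extract (inj₂ (S , S∈ , avoids)) =
          let (c , c∈ , c∉) = outside fresh (kernel sets S∈) (inF sets S∈) len
              (d , P , eq) = pair-at c∈ c∉ S∈
          in c , d , P , avoids c∈ c∉ , avoids (subst (d ∈_) eq (proj₁ (b∈ P))) (proj₂ (b∈ P))

      -- Two petals sharing a would yield two fans {c₁, d₁} and {c₂, d₂}. The vertex c₁ is dominated
      -- by c₂, giving a triangle with b, or by d₂, giving a triangle with a. The 5 bounds the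
      -- vertices to be avoided: a, b, b′ and at most two more.
      pairs-disjoint : ¬ (length ys ≤ 5 * suc k) → ∀ {S T} → S ∈ˡ ys → T ∈ˡ ys → S ≢ T → MeetIn L S T
      pairs-disjoint many {S} {T} S∈ T∈ S≢T {a} a∈S a∈T with a ∈ˡ? L
      ... | yes a∈L = a∈L
      ... | no a∉L = ⊥-elim (clash (pair-at a∈S a∉L S∈) (pair-at a∈T a∉L T∈))
        where
        conclude : ∀ {b b′} → (P : Pair a b) (P′ : Pair a b′) → b ≢ b′ → ⊥
        conclude {b} {b′} P P′ b≢b′ = crown F₁ (F₂ F₁)
          where
          bb′ : Edge b b′
          bb′ with strike P (exchange P′) (≢-sym (a≢b P′)) (≢-sym b≢b′)
          ... | inj₁ (e , _) = ⊥-elim (independent (set∈ P′) (proj₁ (a∈ P′)) (proj₂ (a∈ P′)) (proj₁ (b∈ P′)) (proj₂ (b∈ P′)) e)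
          ... | inj₂ e = e
          next : ∀ C → length C ≤ 2 → Fan a b b′ C
          next C C≤2 = let (_ , _ , R , c∉ , d∉) = fresh-pair many (a ∷ b ∷ b′ ∷ C) (s≤s (s≤s (s≤s C≤2))) in fan P P′ bb′ R c∉ d∉
          F₁ = next [] z≤n
          F₂ : (F₁ : Fan a b b′ []) → Fan a b b′ (Fan.c F₁ ∷ [])
          F₂ F₁ = next (Fan.c F₁ ∷ []) (s≤s z≤n)
          crown : (F₁ : Fan a b b′ []) → Fan a b b′ (Fan.c F₁ ∷ []) → ⊥
          crown F₁ F₂ with strike (Fan.P F₂) (Fan.P F₁) (λ p → Fan.c∉ F₂ (there (there (there (here (sym p))))))
                             (λ p → Fan.d∉ F₂ (there (there (there (here (sym p))))))
          ... | inj₁ c₂c₁ = triangle (Fan.b-c F₂) c₂c₁ (Fan.b-c F₁)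
          ... | inj₂ d₂c₁ = triangle (Fan.a-d F₂) d₂c₁ (Fan.a-c F₁)
        clash : (∃ λ b → Σ (Pair a b) λ P → set P ≡ S) → (∃ λ b → Σ (Pair a b) λ P → set P ≡ T) → ⊥
        clash (b , P , eq) (b′ , P′ , eq′) with b Fin.≟ b′
        ... | yes refl = S≢T (trans (sym eq) (trans (same-set P P′) eq′))
        ... | no b≢b′ = conclude P P′ b≢b′

      -- Disjoint petals of size two fit beside L into the m vertices. With |L| = r - 2 this is the
      -- source of the value (m - r + 2) / 2.
      link-matching : length ys ≤ 5 * suc k ⊎ length L + length ys * 2 ≤ m
      link-matching with length ys ≤? 5 * suc k
      ... | yes le = inj₁ le
      ... | no many = inj₂ (≤-trans (≤-reflexive (sym len-all)) (≤-trans (unique-length-≤ all-unique (λ {x} _ → ∈-allFin x)) (≤-reflexive (length-tabulate {n = m} id))))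
        where
        all-unique : Unique (L ++ concat (map (petal L) ys))
        all-unique = Unique.concat⁺ {xss = L ∷ map (petal L) ys}
          (fresh ∷ All.map⁺ (All.tabulate (λ {S} _ → petal-unique L S)))
          (All.map⁺ (All.tabulate (λ {S} _ (x∈L , x∈P) → proj₂ (∈-petal⁻ {L = L} {S} x∈P) x∈L)) ∷
           AllPairs.map⁺ (allPairs-∈ (distinct sets) λ {S} {T} S∈ T∈ S≢T (x∈S , x∈T) →
             let (x∈S′ , x∉L) = ∈-petal⁻ {L = L} {S} x∈S in x∉L (pairs-disjoint many S∈ T∈ S≢T x∈S′ (proj₁ (∈-petal⁻ {L = L} {T} x∈T)))))
        len-concat : ∀ zs → zs ⊆ˡ ys → length (concat (map (petal L) zs)) ≡ length zs * 2
        len-concat [] _ = refl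
        len-concat (S ∷ zs) sub = trans (length-++ (petal L S)) (cong₂ _+_
          (petal-size fresh (kernel sets (sub (here refl))) (trans (sizes X (inF sets (sub (here refl)))) (sym len)))
          (len-concat zs (sub ∘ there)))
        len-all : length (L ++ concat (map (petal L) ys)) ≡ length L + length ys * 2
        len-all = trans (length-++ L) (cong (length L +_) (len-concat ys id))

-- Uniform sunflowers

-- The default value makes indexing total without a length proof in its type; it is not reached for
-- lists of length d.
nth : {A : Set} {d : ℕ} → A → List A → Fin d → A
nth v [] _ = v
nth v (x ∷ xs) zero = x
nth v (x ∷ xs) (suc i) = nth v xs i

nth-∈ : {A : Set} {d : ℕ} (v : A) {xs : List A} → length xs ≡ d → (i : Fin d) → nth v xs i ∈ˡ xs
nth-∈ v {x ∷ xs} refl zero = here refl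
nth-∈ v {x ∷ xs} refl (suc i) = there (nth-∈ v refl i)

∈-nth : {A : Set} {d : ℕ} (v : A) {xs : List A} → length xs ≡ d → ∀ {x} → x ∈ˡ xs → ∃ λ (i : Fin d) → x ≡ nth v xs i
∈-nth v refl (here refl) = zero , refl
∈-nth v refl (there x∈) = let (i , eq) = ∈-nth v refl x∈ in suc i , eq

nth-injective : {A : Set} {d : ℕ} (v : A) {xs : List A} → length xs ≡ d → Unique xs → {i j : Fin d} → nth v xs i ≡ nth v xs j → i ≡ j
nth-injective v {x ∷ xs} refl u {zero} {zero} eq = refl
nth-injective v {x ∷ xs} refl u {zero} {suc j} eq = contradiction (subst (_∈ˡ xs) (sym eq) (nth-∈ v refl j)) (Unique.Unique[x∷xs]⇒x∉xs u)
nth-injective v {x ∷ xs} refl u {suc i} {zero} eq = contradiction (subst (_∈ˡ xs) eq (nth-∈ v refl i)) (Unique.Unique[x∷xs]⇒x∉xs u)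
nth-injective v {x ∷ xs} refl (_ ∷ u) {suc i} {suc j} eq = cong suc (nth-injective v refl u eq)

-- What a set with kernel of size k and petal of size d is compared on: the
-- adjacencies of its i-th petal vertex to the kernel and to the other petal vertices.
Key : ℕ → ℕ → Set
Key d k = Fin d × (Fin k ⊎ Fin d)

keys : ∀ d k → List (Key d k)
keys d k = cartesianProduct (allFin d) (map inj₁ (allFin k) ++ map inj₂ (allFin d))

∈-keys : ∀ {d k} (κ : Key d k) → κ ∈ˡ keys d k
∈-keys (i , inj₁ j) = ∈-cartesianProduct⁺ (∈-allFin i) (∈-++⁺ˡ (∈-map⁺ inj₁ (∈-allFin j)))
∈-keys {k = k} (i , inj₂ j) = ∈-cartesianProduct⁺ (∈-allFin i) (∈-++⁺ʳ (map inj₁ (allFin k)) (∈-map⁺ inj₂ (∈-allFin j)))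

abstract
  -- One factor counts the adjacency patterns, the other bounds a class of equal pattern that has no
  -- sunflower with t + 1 petals. It is abstract so that the power is never evaluated.
  flower-bound : ℕ → ℕ → ℕ → ℕ → ℕ
  flower-bound d k t b = 2 ^ length (keys d k) * (suc t * d * b)

  flower-bound-≥ : ∀ d k t b {n} → n ≤ 2 ^ length (keys d k) * (suc t * d * b) → n ≤ flower-bound d k t b
  flower-bound-≥ d k t b le = le

  flower-bound-* : ∀ d k t n b → flower-bound d k t (n * b) ≡ n * flower-bound d k t b
  flower-bound-* d k t n b = rearrange (2 ^ length (keys d k)) (suc t * d) n b
    where
    rearrange : ∀ w x y z → w * (x * (y * z)) ≡ y * (w * (x * z))
    rearrange = solve-∀

-- Kernel cliques and the vertex missed by the petals

module Kernel {k t m : ℕ} (X : System (2 + k) t m) {K : List (Fin m)}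
  (clK : Clique (H X) K) (lenK : length K ≡ k) where
  open Facts X
  open Link X

  uK : Unique K
  uK = clique-unique (H X) clK

  sub-clique : ∀ {A} → Unique A → A ⊆ˡ K → Clique (H X) A
  sub-clique uA sub = allPairs-∈ uA λ x∈ y∈ → clique-lookup (H X) clK (sub x∈) (sub y∈)

  Apex : Fin m → Set
  Apex p = p ∈ˡ K × (∀ {y z} → y ∉ˡ K → z ∈ˡ K → z ≢ p → y ~ z)

  module WithApex {p} (p∈K : p ∈ˡ K) where

    K′ : List (Fin m)
    K′ = filter (λ z → ¬? (z Fin.≟ p)) K

    K′⁻ : ∀ {z} → z ∈ˡ K′ → z ∈ˡ K × z ≢ p
    K′⁻ = ∈-filter⁻ (λ z → ¬? (z Fin.≟ p)) {xs = K}

    clK′ : Clique (H X) K′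
    clK′ = AllPairs.filter⁺ (λ z → ¬? (z Fin.≟ p)) clK

    k≤1+K′ : k ≤ suc (length K′)
    k≤1+K′ = ≤-trans (≤-reflexive (sym lenK)) (unique-length-≤ uK K⊆)
      where
      K⊆ : K ⊆ˡ p ∷ K′
      K⊆ {z} z∈ with z Fin.≟ p
      ... | yes eq = here eq
      ... | no neq = there (∈-filter⁺ (λ z → ¬? (z Fin.≟ p)) z∈ neq)

    1+K′≤k : suc (length K′) ≤ k
    1+K′≤k = ≤-trans (unique-length-≤ (∷-unique (λ p∈ → proj₂ (K′⁻ p∈) refl) (clique-unique (H X) clK′))
      (λ { (here refl) → p∈K ; (there z∈) → proj₁ (K′⁻ z∈) })) (≤-reflexive lenK)

  -- K′ = K - p has k - 1 vertices and is joined to everything outside K. An edge inside a petal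
  -- would extend it to a (k+1)-clique of a member, a triangle outside K to a (k+2)-clique. A
  -- k-clique that dominates a petal vertex y cannot lie in K, since it would contain p, which y
  -- does not see.
  apex-link : ∀ {p ys} → Apex p → Above K ys → TriangleFreeLink K ys
  apex-link {p} {ys} (p∈K , joined) ab = record
    { fresh = uK ; sets = ab ; independent = independent ; dominating = dominating ; no-triangle = no-triangle }
    where
    open WithApex p∈K
    cone : ∀ {x} → x ∉ˡ K → ∀ {z} → z ∈ˡ K′ → x ~ z
    cone x∉ z∈ = let (z∈K , z≢p) = K′⁻ z∈ in joined x∉ z∈K z≢p
    K′⊑ : ∀ {S} → S ∈ˡ ys → K′ ⊑ S
    K′⊑ S∈ = kernel ab S∈ ∘ proj₁ ∘ K′⁻
    independent : ∀ {S x y} → S ∈ˡ ys → x ∈ S → x ∉ˡ K → y ∈ S → y ∉ˡ K → ¬ x ~ y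
    independent S∈ x∈ x∉ y∈ y∉ e = contradiction
      (free-bound (inF ab S∈) (clique-∷ (H X) (λ { (here refl) → e ; (there z∈) → cone x∉ z∈ }) (clique-∷ (H X) (cone y∉) clK′))
        (∷-⊑ x∈ (∷-⊑ y∈ (K′⊑ S∈)))) (<⇒≱ (s≤s k≤1+K′))
    p-apart : ∀ {S x} → S ∈ˡ ys → x ∈ S → x ∉ˡ K → ¬ x ~ p
    p-apart {S} {x} S∈ x∈ x∉ e = contradiction
      (free-bound (inF ab S∈) (clique-∷ (H X) x~ clK) (∷-⊑ x∈ (kernel ab S∈)))
      (<⇒≱ (s≤s (≤-reflexive (sym lenK))))
      where
      x~ : ∀ {z} → z ∈ˡ K → x ~ z
      x~ {z} z∈ with z Fin.≟ p
      ... | yes refl = e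
      ... | no neq = joined x∉ z∈ neq
    dominating : ∀ {S T y} → S ∈ˡ ys → T ∈ˡ ys → y ∈ T → y ∉ˡ K → y ∉ S → ∃ λ x → x ∈ S × x ∉ˡ K × x ~ y
    dominating S∈ T∈ y∈T y∉K y∉S with dominated (inF ab S∈) y∉S
    ... | W , clW , W⊑S , k≤W , y~W with all? (_∈ˡ? K) W
    ...   | no ¬all = let (w , w∈ , w∉) = find (All.¬All⇒Any¬ (_∈ˡ? K) W ¬all) in w , W⊑S w∈ , w∉ , flip (H X) (y~W w∈)
    ...   | yes all = contradiction (≤-trans k≤W (unique-length-≤ (clique-unique (H X) clW) W⊆K′)) (<⇒≱ 1+K′≤k)
      where
      W⊆K′ : W ⊆ˡ K′
      W⊆K′ w∈ = ∈-filter⁺ (λ z → ¬? (z Fin.≟ p)) (All.lookup all w∈) λ { refl → p-apart T∈ y∈T y∉K (y~W w∈) }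
    no-triangle : ∀ {x y z} → x ∉ˡ K → y ∉ˡ K → z ∉ˡ K → x ~ y → y ~ z → x ~ z → ⊥
    no-triangle x∉ y∉ z∉ xy yz xz = contradiction
      (clique-bound (clique-∷ (H X) (λ { (here refl) → xy ; (there (here refl)) → xz ; (there (there v∈)) → cone x∉ v∈ })
        (clique-∷ (H X) (λ { (here refl) → yz ; (there v∈) → cone y∉ v∈ }) (clique-∷ (H X) (cone z∉) clK′))))
      (<⇒≱ (s≤s (s≤s k≤1+K′)))

  Miss : Fin m → Fin m → Set
  Miss p x = ¬ x ~ p × (∀ {z} → z ∈ˡ K → z ≢ p → x ~ z)

  module InSet {R : Subset m} (R∈ : R ∈ˡ F X) (K⊑R : K ⊑ R) where

    not-full : ∀ {x} → x ∈ R → ¬ (∀ {z} → z ∈ˡ K → x ~ z)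
    not-full x∈ x~K = contradiction (free-bound R∈ (clique-∷ (H X) x~K clK) (∷-⊑ x∈ K⊑R)) (<⇒≱ (s≤s (≤-reflexive (sym lenK))))

    -- By the hypothesis R - K′ is independent, so a clique dominating a vertex y outside R has at
    -- most one vertex off K′. Having at least k vertices, it contains all k - 1 of K′.
    miss-all⇒apex : ∀ {p} → p ∈ˡ K → (∀ {x} → x ∈ R → x ∉ˡ K → Miss p x) → Apex p
    miss-all⇒apex {p} p∈K miss = p∈K , joined
      where
      open WithApex p∈K
      off : Fin m → Set
      off x = x ∉ˡ K′
      scattered : ∀ {x y} → x ∈ R → y ∈ R → off x → off y → ¬ x ~ y
      scattered {x} {y} x∈ y∈ x∉ y∉ e with x ∈ˡ? K | y ∈ˡ? K
      ... | no x∉K | no y∉K = contradiction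
              (free-bound R∈ (clique-∷ (H X) (λ { (here refl) → e ; (there z∈) → cone x∈ x∉K z∈ }) (clique-∷ (H X) (cone y∈ y∉K) clK′))
                (∷-⊑ x∈ (∷-⊑ y∈ (K⊑R ∘ proj₁ ∘ K′⁻)))) (<⇒≱ (s≤s k≤1+K′))
        where
        cone : ∀ {x z} → x ∈ R → x ∉ˡ K → z ∈ˡ K′ → x ~ z
        cone x∈ x∉K z∈ = let (z∈K , z≢p) = K′⁻ z∈ in proj₂ (miss x∈ x∉K) z∈K z≢p
      ... | yes x∈K | yes y∈K = contradiction (trans (is-p x∉ x∈K) (sym (is-p y∉ y∈K))) (adj⇒≢ (H X) e)
        where
        is-p : ∀ {z} → off z → z ∈ˡ K → z ≡ p
        is-p {z} z∉ z∈ = decidable-stable (z Fin.≟ p) (λ neq → z∉ (∈-filter⁺ (λ z → ¬? (z Fin.≟ p)) z∈ neq))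
      ... | yes x∈K | no y∉K = proj₁ (miss y∈ y∉K) (flip (H X) (subst (_~ y) (decidable-stable (x Fin.≟ p) (λ neq → x∉ (∈-filter⁺ (λ z → ¬? (z Fin.≟ p)) x∈K neq))) e))
      ... | no x∉K | yes y∈K = proj₁ (miss x∈ x∉K) (subst (x ~_) (decidable-stable (y Fin.≟ p) (λ neq → y∉ (∈-filter⁺ (λ z → ¬? (z Fin.≟ p)) y∈K neq))) e)
      scattered-clique : ∀ {V} → Clique (H X) V → V ⊑ R → (∀ {v} → v ∈ˡ V → off v) → length V ≤ 1
      scattered-clique [] _ _ = z≤n
      scattered-clique ([] ∷ _) _ _ = s≤s z≤n
      scattered-clique ((e ∷ _) ∷ _) sub all-off =
        ⊥-elim (scattered (sub (here refl)) (sub (there (here refl))) (all-off (here refl)) (all-off (there (here refl))) e)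
      joined : ∀ {y z} → y ∉ˡ K → z ∈ˡ K → z ≢ p → y ~ z
      joined {y} {z} y∉K z∈K z≢p with y ∈? R
      ... | yes y∈R = proj₂ (miss y∈R y∉K) z∈K z≢p
      ... | no y∉R with adj? (H X) y z
      ...   | yes e = e
      ...   | no ¬e with dominated R∈ y∉R
      ...     | W , clW , W⊑R , k≤W , y~W = contradiction few (<⇒≱ (s≤s k≤W))
        where
        in? = _∈ˡ? K′
        W₁ = filter in? W
        W₂ = filter (¬? ∘ in?) W
        W₁<K′ : suc (length W₁) ≤ length K′
        W₁<K′ = unique-length-≤ (∷-unique (λ z∈ → ¬e (y~W (proj₁ (∈-filter⁻ in? {xs = W} z∈)))) (Unique.filter⁺ in? (clique-unique (H X) clW)))
          λ { (here refl) → ∈-filter⁺ (λ z → ¬? (z Fin.≟ p)) z∈K z≢p ; (there w∈) → proj₂ (∈-filter⁻ in? {xs = W} w∈) }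
        W₂≤1 : length W₂ ≤ 1
        W₂≤1 = scattered-clique (AllPairs.filter⁺ (¬? ∘ in?) clW) (W⊑R ∘ proj₁ ∘ ∈-filter⁻ (¬? ∘ in?) {xs = W})
                 (proj₂ ∘ ∈-filter⁻ (¬? ∘ in?) {xs = W})
        few : suc (length W) ≤ k
        few = ≤-trans (≤-reflexive (cong suc (length-filter-split in? W)))
                (≤-trans (+-mono-≤ W₁<K′ W₂≤1) (≤-trans (≤-reflexive (+-comm (length K′) 1)) 1+K′≤k))

    -- The number n is how many vertices of K may fail to be common neighbours of V. A clique V in R
    -- needs n ≥ |V|, as otherwise V with A exceeds k vertices.
    Common : List (Fin m) → ℕ → Set
    Common V n = ∃ λ A → Unique A × A ⊆ˡ K × (∀ {v z} → v ∈ˡ V → z ∈ˡ A → v ~ z) × k ≤ n + length A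

    common-⊆ : ∀ {V V′ n} → V′ ⊆ˡ V → Common V n → Common V′ n
    common-⊆ sub (A , uA , A⊆ , joined , le) = A , uA , A⊆ , joined ∘ sub , le

    overfull : ∀ {V n} → Clique (H X) V → V ⊑ R → Common V n → n < length V → ⊥
    overfull {V} clV V⊑R (A , uA , A⊆ , joined , le) lt = contradiction
      (free-bound R∈ (AllPairs.++⁺ clV (sub-clique uA A⊆) (All.tabulate (λ v∈ → All.tabulate (joined v∈)))) sub)
      (<⇒≱ (≤-trans (s≤s le) (≤-trans (+-monoˡ-≤ (length A) lt) (≤-reflexive (sym (length-++ V))))))
      where
      sub : (V ++ A) ⊑ R
      sub x∈ with ∈-++⁻ V x∈
      ... | inj₁ x∈V = V⊑R x∈V
      ... | inj₂ x∈A = K⊑R (A⊆ x∈A)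

    -- Some kernel vertex is missed by x, so x has at most k - 1 neighbours in K. Both sets of
    -- common neighbours have at least k - 1 elements, hence both are all of these neighbours.
    exchange-common : ∀ {x y z} → x ∈ R → Common (x ∷ y ∷ []) 1 → Common (x ∷ z ∷ []) 1 → Common (y ∷ z ∷ []) 1
    exchange-common {x} {y} {z} x∈ (A , uA , A⊆ , jA , leA) (B , uB , B⊆ , jB , leB) =
      A , uA , A⊆ , (λ { (here refl) a∈ → jA (there (here refl)) a∈ ; (there (here refl)) a∈ → jB (there (here refl)) (A⊆B a∈) }) , leA
      where
      N? = adj? (H X) x
      N = filter N? K
      uN = Unique.filter⁺ N? uK
      N<k : suc (length N) ≤ k
      N<k = free-bound R∈ (clique-∷ (H X) (proj₂ ∘ ∈-filter⁻ N? {xs = K}) (sub-clique uN (proj₁ ∘ ∈-filter⁻ N? {xs = K})))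
              (∷-⊑ x∈ (K⊑R ∘ proj₁ ∘ ∈-filter⁻ N? {xs = K}))
      A⊆B : A ⊆ˡ B
      A⊆B a∈ = unique-tight uB (λ b∈ → ∈-filter⁺ N? (B⊆ b∈) (jB (here refl) b∈)) (s≤s⁻¹ (≤-trans N<k leB))
                 (∈-filter⁺ N? (A⊆ a∈) (jA (here refl) a∈))

    -- With p the common neighbours exhaust K. Since y cannot see all of K either, p is also the
    -- vertex missed by y.
    miss-both : ∀ {p x y} → x ∈ R → y ∈ R → p ∈ˡ K → ¬ x ~ p → Common (x ∷ y ∷ []) 1 → Miss p x × Miss p y
    miss-both {p} {x} {y} x∈ y∈ p∈K ¬xp (A , uA , A⊆ , joined , le) =
      (¬xp , (λ z∈ neq → joined (here refl) (rest z∈ neq))) ,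
      (λ yp → not-full y∈ (λ {z} z∈ → full yp z∈ (z Fin.≟ p))) , (λ z∈ neq → joined (there (here refl)) (rest z∈ neq))
      where
      K⊆pA : K ⊆ˡ p ∷ A
      K⊆pA = unique-tight (∷-unique (¬xp ∘ joined (here refl)) uA) (λ { (here refl) → p∈K ; (there a∈) → A⊆ a∈ }) (≤-trans (≤-reflexive lenK) le)
      rest : ∀ {z} → z ∈ˡ K → z ≢ p → z ∈ˡ A
      rest z∈ neq = ∈∷⁻ (K⊆pA z∈) neq
      full : ∀ {z} → y ~ p → z ∈ˡ K → Dec (z ≡ p) → y ~ z
      full yp z∈ (yes refl) = yp
      full yp z∈ (no neq) = joined (there (here refl)) (rest z∈ neq)

    missed : ∀ {x} → x ∈ R → ∃ λ p → p ∈ˡ K × ¬ x ~ p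
    missed {x} x∈ with all? (adj? (H X) x) K
    ... | yes all = ⊥-elim (not-full x∈ (All.lookup all))
    ... | no ¬all = let (p , p∈ , ¬e) = find (All.¬All⇒Any¬ (adj? (H X) x) K ¬all) in p , p∈ , ¬e

    -- The ways in which a transported clique avoiding x can use the other vertices y, z of a petal
    -- of size three: both of them, y alone, or z alone.
    Support : Fin m → Fin m → Fin m → Set
    Support x y z = (y ~ z × Common (x ∷ y ∷ z ∷ []) 2) ⊎ Common (x ∷ y ∷ []) 1 ⊎ Common (x ∷ z ∷ []) 1

    support-swap : ∀ {x y z} → Support x y z → Support x z y
    support-swap (inj₁ (e , c)) = inj₁ (flip (H X) e , common-⊆ (λ { (here p) → here p ; (there (here p)) → there (there (here p)) ; (there (there (here p))) → there (here p) }) c)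
    support-swap (inj₂ (inj₁ c)) = inj₂ (inj₂ c)
    support-swap (inj₂ (inj₂ c)) = inj₂ (inj₁ c)

    rev-common : ∀ {x y} → Common (x ∷ y ∷ []) 1 → Common (y ∷ x ∷ []) 1
    rev-common = common-⊆ λ { (here p) → there (here p) ; (there (here p)) → here p }

    two⊑ : ∀ {x y} → x ∈ R → y ∈ R → (x ∷ y ∷ []) ⊑ R
    two⊑ x∈ y∈ = ∷-⊑ x∈ (∷-⊑ y∈ λ ())

    edge-overfull : ∀ {x y} → x ∈ R → y ∈ R → x ~ y → ¬ Common (x ∷ y ∷ []) 1
    edge-overfull x∈ y∈ e c = overfull ((e ∷ []) ∷ [] ∷ []) (two⊑ x∈ y∈) c (s≤s (s≤s z≤n))

    -- Every combination exceeds k vertices inside R: either an edge whose ends share k - 1 kernel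
    -- vertices, or the triangle a b c with k - 2 of them. If b and c are each supported by a alone,
    -- `exchange-common` first turns this into common neighbours of b and c.
    no-pair-support : ∀ {a b c} → a ∈ R → b ∈ R → c ∈ R → b ~ c → Common (a ∷ b ∷ c ∷ []) 2 → Support b a c → Support c a b → ⊥
    no-pair-support a∈ b∈ c∈ bc abc (inj₂ (inj₂ cbc)) _ = edge-overfull b∈ c∈ bc cbc
    no-pair-support a∈ b∈ c∈ bc abc _ (inj₂ (inj₂ ccb)) = edge-overfull b∈ c∈ bc (rev-common ccb)
    no-pair-support a∈ b∈ c∈ bc abc (inj₁ (ac , _)) (inj₁ (ab , _)) =
      overfull ((ab ∷ ac ∷ []) ∷ (bc ∷ []) ∷ [] ∷ []) (∷-⊑ a∈ (two⊑ b∈ c∈)) abc (s≤s (s≤s (s≤s z≤n)))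
    no-pair-support a∈ b∈ c∈ bc abc (inj₁ (ac , _)) (inj₂ (inj₁ cca)) = edge-overfull a∈ c∈ ac (rev-common cca)
    no-pair-support a∈ b∈ c∈ bc abc (inj₂ (inj₁ cba)) (inj₁ (ab , _)) = edge-overfull a∈ b∈ ab (rev-common cba)
    no-pair-support a∈ b∈ c∈ bc abc (inj₂ (inj₁ cba)) (inj₂ (inj₁ cca)) =
      edge-overfull b∈ c∈ bc (exchange-common a∈ (rev-common cba) (rev-common cca))

    -- Supports by two vertices being excluded, each vertex is linked to another one that misses the
    -- same kernel vertex. On three vertices such links connect everything, so p is common to all.
    triple-miss : ∀ {a b c} → a ∈ R → b ∈ R → c ∈ R → Support a b c → Support b a c → Support c a b →
      ∃ λ p → p ∈ˡ K × Miss p a × Miss p b × Miss p c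
    triple-miss a∈ b∈ c∈ (inj₁ (bc , abc)) sb sc = ⊥-elim (no-pair-support a∈ b∈ c∈ bc abc sb sc)
    triple-miss a∈ b∈ c∈ sa (inj₁ (ac , bac)) sc = ⊥-elim (no-pair-support b∈ a∈ c∈ ac bac sa (support-swap sc))
    triple-miss a∈ b∈ c∈ sa sb (inj₁ (ab , cab)) = ⊥-elim (no-pair-support c∈ a∈ b∈ ab cab (support-swap sa) (support-swap sb))
    triple-miss a∈ b∈ c∈ (inj₂ (inj₁ cab)) _ (inj₂ sc) =
      let (p , p∈ , ¬ap) = missed a∈
          (ma , mb) = miss-both a∈ b∈ p∈ ¬ap cab
      in p , p∈ , ma , mb , ([ (λ cca → proj₂ (miss-both a∈ c∈ p∈ ¬ap (rev-common cca)))
                             , (λ ccb → proj₂ (miss-both b∈ c∈ p∈ (proj₁ mb) (rev-common ccb))) ]′ sc)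
    triple-miss a∈ b∈ c∈ (inj₂ (inj₂ cac)) (inj₂ sb) _ =
      let (p , p∈ , ¬ap) = missed a∈
          (ma , mc) = miss-both a∈ c∈ p∈ ¬ap cac
      in p , p∈ , ma , ([ (λ cba → proj₂ (miss-both a∈ b∈ p∈ ¬ap (rev-common cba)))
                        , (λ cbc → proj₂ (miss-both c∈ b∈ p∈ (proj₁ mc) (rev-common cbc))) ]′ sb) , mc

  -- Transport of cliques within a uniform sunflower

  module Uniform {d : ℕ} (v₀ : Fin m) (lenT : length K + d ≡ t) where

    at : Subset m → Fin d → Fin m
    at S = nth v₀ (petal K S)

    target : Subset m → Fin (length K) ⊎ Fin d → Fin m
    target S (inj₁ j) = lookup K j
    target S (inj₂ j) = at S j

    profile : Key d (length K) → Subset m → Bool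
    profile (i , κ) S = adj (H X) (at S i) (target S κ)

    record UniformSunflower (zs : List (Subset m)) : Set where
      field
        zs⊆F    : zs ⊆ˡ F X
        K⊑      : ∀ {S} → S ∈ˡ zs → K ⊑ S
        meet    : AllPairs (MeetIn K) zs
        big     : 2 + k ≤ length zs
        uniform : ∀ {κ S T} → S ∈ˡ zs → T ∈ˡ zs → profile κ S ≡ profile κ T

      petal-length : ∀ {S} → S ∈ˡ zs → length (petal K S) ≡ d
      petal-length S∈ = petal-size uK (K⊑ S∈) (trans (sizes X (zs⊆F S∈)) (sym lenT))

      at-∈ : ∀ {S} → S ∈ˡ zs → ∀ i → at S i ∈ S × at S i ∉ˡ K
      at-∈ {S} S∈ i = ∈-petal⁻ {L = K} {S} (nth-∈ v₀ (petal-length S∈) i)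

      ∈-at : ∀ {S x} → S ∈ˡ zs → x ∈ S → x ∉ˡ K → ∃ λ i → x ≡ at S i
      ∈-at S∈ x∈ x∉ = ∈-nth v₀ (petal-length S∈) (∈-petal⁺ x∈ x∉)

      kernel-adj : ∀ {S T i z} → S ∈ˡ zs → T ∈ˡ zs → z ∈ˡ K → at S i ~ z → at T i ~ z
      kernel-adj {S} {T} {i} S∈ T∈ z∈ e = subst (at T i ~_) (sym (lookup-index z∈))
        (trans (sym (uniform {i , inj₁ (Any.index z∈)} S∈ T∈)) (subst (at S i ~_) (lookup-index z∈) e))

      petal-adj : ∀ {S T i j} → S ∈ˡ zs → T ∈ˡ zs → at S i ~ at S j → at T i ~ at T j
      petal-adj {i = i} {j} S∈ T∈ e = trans (sym (uniform {i , inj₂ j} S∈ T∈)) e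

      -- The copy in R of a clique by which one member dominates the i-th petal vertex of another: Z
      -- is its part in K, and U holds the positions of its petal vertices. Adjacency between
      -- different petals is not part of the profile, so the i-th vertex of R is known to see Z but
      -- not the positions in U.
      record Shadow (R : Subset m) (i : Fin d) : Set₁ where
        field
          {Z}    : List (Fin m)
          {U}    : Fin d → Set
          U?     : Decidable U
          i∉U    : ¬ U i
          uZ     : Unique Z
          Z⊆K    : Z ⊆ˡ K
          enough : k ≤ length Z + length (filter U? (allFin d))
          own    : ∀ {z} → z ∈ˡ Z → at R i ~ z
          others : ∀ {j z} → U j → z ∈ˡ Z → at R j ~ z
          linked : ∀ {j l} → U j → U l → j ≢ l → at R j ~ at R l

      -- The i-th petal vertices cannot all be adjacent, as there are too many of them for a clique;
      -- two that are not adjacent give a clique avoiding index i, which uniformity moves into R.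
      shadow : ∀ {R} → R ∈ˡ zs → ∀ i → Shadow R i
      shadow {R} R∈ i with allPairs⊎counterexample (λ S T → adj? (H X) (at S i) (at T i)) meet
      ... | inj₁ cl = contradiction (clique-bound (AllPairs.map⁺ {f = λ S → at S i} cl))
                        (<⇒≱ (≤-trans big (≤-reflexive (sym (length-map (λ S → at S i) zs)))))
      ... | inj₂ (S , T , S∈ , T∈ , meets , ¬e) with dominated (zs⊆F S∈) (λ x∈S → proj₂ (at-∈ T∈ i) (meets x∈S (proj₁ (at-∈ T∈ i))))
      ...   | W , clW , W⊑S , k≤W , x~W = record
        { U? = U? ; i∉U = λ i∈ → ¬e (flip (H X) (x~W i∈)) ; uZ = Unique.filter⁺ K? uW ; Z⊆K = proj₂ ∘ Z⁻ ; enough = enough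
        ; own = λ z∈ → kernel-adj T∈ R∈ (proj₂ (Z⁻ z∈)) (x~W (proj₁ (Z⁻ z∈)))
        ; others = λ {j} j∈ z∈ → kernel-adj S∈ R∈ (proj₂ (Z⁻ z∈)) (clique-lookup (H X) clW j∈ (proj₁ (Z⁻ z∈))
                     (λ eq → proj₂ (at-∈ S∈ j) (subst (_∈ˡ K) (sym eq) (proj₂ (Z⁻ z∈)))))
        ; linked = λ j∈ l∈ j≢l → petal-adj S∈ R∈ (clique-lookup (H X) clW j∈ l∈
                     (j≢l ∘ nth-injective v₀ (petal-length S∈) (petal-unique K S))) }
        where
        uW = clique-unique (H X) clW
        K? = _∈ˡ? K
        U? : Decidable (λ j → at S j ∈ˡ W)
        U? j = at S j ∈ˡ? W
        Z⁻ : ∀ {z} → z ∈ˡ filter K? W → z ∈ˡ W × z ∈ˡ K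
        Z⁻ = ∈-filter⁻ K? {xs = W}
        W⊆ : W ⊆ˡ filter K? W ++ map (at S) (filter U? (allFin d))
        W⊆ {w} w∈ with w ∈ˡ? K
        ... | yes w∈K = ∈-++⁺ˡ (∈-filter⁺ K? w∈ w∈K)
        ... | no w∉K with ∈-at S∈ (W⊑S w∈) w∉K
        ...   | j , refl = ∈-++⁺ʳ (filter K? W) (∈-map⁺ (at S) (∈-filter⁺ U? (∈-allFin j) w∈))
        enough = ≤-trans k≤W (≤-trans (unique-length-≤ uW W⊆)
          (≤-reflexive (trans (length-++ (filter K? W)) (cong (length (filter K? W) +_) (length-map (at S) (filter U? (allFin d)))))))

      module _ {R : Subset m} (R∈ : R ∈ˡ zs) where
        open InSet (zs⊆F R∈) (K⊑ R∈)

        module _ {i : Fin d} (sh : Shadow R i) where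
          open Shadow sh

          shadow-count : ∀ V → (∀ {j} → U j → j ∈ˡ V) → k ≤ length V + length Z
          shadow-count V sub = ≤-trans enough (≤-trans (≤-reflexive (+-comm (length Z) _))
            (+-monoˡ-≤ (length Z) (unique-length-≤ (Unique.filter⁺ U? (Unique.allFin⁺ d)) (sub ∘ proj₂ ∘ ∈-filter⁻ U? {xs = allFin d}))))

          -- With U empty the clique would be all of K, and the i-th petal vertex of R would see all
          -- of K inside R.
          shadow-nonempty : ¬ (∀ {j} → ¬ U j)
          shadow-nonempty none = overfull {V = at R i ∷ []} ([] ∷ []) (∷-⊑ (proj₁ (at-∈ R∈ i)) λ ())
            (Z , uZ , Z⊆K , (λ { (here refl) → own }) , shadow-count [] (⊥-elim ∘ none)) (s≤s z≤n)

          single-support : ∀ {j} → U j → (∀ {l} → U l → l ≡ j) → Common (at R i ∷ at R j ∷ []) 1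
          single-support {j} j∈ is-j = Z , uZ , Z⊆K , (λ { (here refl) → own ; (there (here refl)) → others j∈ }) , shadow-count (j ∷ []) (here ∘ is-j)

          pair-support : ∀ {j l} → (∀ x → x ≡ i ⊎ x ≡ j ⊎ x ≡ l) → j ≢ l → Support (at R i) (at R j) (at R l)
          pair-support {j} {l} cov j≢l with U? j | U? l
          ... | no j∉ | no l∉ = ⊥-elim (shadow-nonempty λ {x} → none (cov x))
            where
            none : ∀ {x} → x ≡ i ⊎ x ≡ j ⊎ x ≡ l → ¬ U x
            none (inj₁ refl) = i∉U
            none (inj₂ (inj₁ refl)) = j∉
            none (inj₂ (inj₂ refl)) = l∉
          ... | yes j∈ | no l∉ = inj₂ (inj₁ (single-support j∈ λ {x} x∈ → pick x∈ (cov x)))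
            where
            pick : ∀ {x} → U x → x ≡ i ⊎ x ≡ j ⊎ x ≡ l → x ≡ j
            pick x∈ (inj₁ refl) = contradiction x∈ i∉U
            pick x∈ (inj₂ (inj₁ p)) = p
            pick x∈ (inj₂ (inj₂ refl)) = contradiction x∈ l∉
          ... | no j∉ | yes l∈ = inj₂ (inj₂ (single-support l∈ λ {x} x∈ → pick x∈ (cov x)))
            where
            pick : ∀ {x} → U x → x ≡ i ⊎ x ≡ j ⊎ x ≡ l → x ≡ l
            pick x∈ (inj₁ refl) = contradiction x∈ i∉U
            pick x∈ (inj₂ (inj₁ refl)) = contradiction x∈ j∉
            pick x∈ (inj₂ (inj₂ p)) = p
          ... | yes j∈ | yes l∈ = inj₁ (linked j∈ l∈ j≢l , Z , uZ , Z⊆K ,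
                  (λ { (here refl) → own ; (there (here refl)) → others j∈ ; (there (there (here refl))) → others l∈ }) ,
                  shadow-count (j ∷ l ∷ []) λ {x} x∈ → pick x∈ (cov x))
            where
            pick : ∀ {x} → U x → x ≡ i ⊎ x ≡ j ⊎ x ≡ l → x ∈ˡ j ∷ l ∷ []
            pick x∈ (inj₁ refl) = contradiction x∈ i∉U
            pick x∈ (inj₂ (inj₁ p)) = here p
            pick x∈ (inj₂ (inj₂ p)) = there (here p)

  HasApex : ∀ {d} → Fin m → length K + d ≡ t → Set
  HasApex v₀ lenT = ∀ {zs} → UniformSunflower zs → ∃ Apex
    where open Uniform v₀ lenT

  -- The shadow of position 0 avoids 0 and is not empty, so it uses exactly position 1. Hence the
  -- two petal vertices share k - 1 kernel neighbours and miss the same vertex.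
  apex₂ : (v₀ : Fin m) (lenT : length K + 2 ≡ t) → HasApex v₀ lenT
  apex₂ v₀ lenT {[]} us = case Uniform.UniformSunflower.big us of λ ()
  apex₂ v₀ lenT {R ∷ _} us = let (p , p∈ , ¬e) = missed (proj₁ (at-∈ R∈ zero)) in
      p , miss-all⇒apex p∈ λ x∈ x∉ → miss (miss-both (proj₁ (at-∈ R∈ zero)) (proj₁ (at-∈ R∈ (suc zero))) p∈ ¬e common) (∈-at R∈ x∈ x∉)
    where
    open Uniform v₀ lenT
    open UniformSunflower us
    R∈ = here refl
    open InSet (zs⊆F R∈) (K⊑ R∈)
    sh = shadow R∈ zero
    open Shadow sh
    only-one : ∀ {j} → U j → j ≡ suc zero
    only-one {zero} j∈ = contradiction j∈ i∉U
    only-one {suc zero} _ = refl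
    common : Common (at R zero ∷ at R (suc zero) ∷ []) 1
    common with U? (suc zero)
    ... | yes j∈ = single-support R∈ sh j∈ only-one
    ... | no j∉ = ⊥-elim (shadow-nonempty R∈ sh λ { {zero} → i∉U ; {suc zero} → j∉ })
    miss : ∀ {p x} → Miss p (at R zero) × Miss p (at R (suc zero)) → (∃ λ i → x ≡ at R i) → Miss p x
    miss (m₀ , _) (zero , refl) = m₀
    miss (_ , m₁) (suc zero , refl) = m₁

  apex₃ : (v₀ : Fin m) (lenT : length K + 3 ≡ t) → HasApex v₀ lenT
  apex₃ v₀ lenT {[]} us = case Uniform.UniformSunflower.big us of λ ()
  apex₃ v₀ lenT {R ∷ _} us = let (p , p∈ , misses) = triple-miss (proj₁ (at-∈ R∈ 0F)) (proj₁ (at-∈ R∈ 1F)) (proj₁ (at-∈ R∈ 2F))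
                                   (pair-support R∈ (shadow R∈ 0F) cov₀ λ ()) (pair-support R∈ (shadow R∈ 1F) cov₁ λ ()) (pair-support R∈ (shadow R∈ 2F) cov₂ λ ())
                             in p , miss-all⇒apex p∈ λ x∈ x∉ → miss misses (∈-at R∈ x∈ x∉)
    where
    open Uniform v₀ lenT
    open UniformSunflower us
    R∈ = here refl
    open InSet (zs⊆F R∈) (K⊑ R∈)
    cov₀ : ∀ x → x ≡ 0F ⊎ x ≡ 1F ⊎ x ≡ 2F
    cov₀ 0F = inj₁ refl
    cov₀ 1F = inj₂ (inj₁ refl)
    cov₀ 2F = inj₂ (inj₂ refl)
    cov₁ : ∀ x → x ≡ 1F ⊎ x ≡ 0F ⊎ x ≡ 2F
    cov₁ 0F = inj₂ (inj₁ refl)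
    cov₁ 1F = inj₁ refl
    cov₁ 2F = inj₂ (inj₂ refl)
    cov₂ : ∀ x → x ≡ 2F ⊎ x ≡ 0F ⊎ x ≡ 1F
    cov₂ 0F = inj₂ (inj₁ refl)
    cov₂ 1F = inj₂ (inj₂ refl)
    cov₂ 2F = inj₁ refl
    miss : ∀ {p x} → Miss p (at R 0F) × Miss p (at R 1F) × Miss p (at R 2F) → (∃ λ i → x ≡ at R i) → Miss p x
    miss (m₀ , _ , _) (0F , refl) = m₀
    miss (_ , m₁ , _) (1F , refl) = m₁
    miss (_ , _ , m₂) (2F , refl) = m₂

  BigSunflower : List (Subset m) → Set
  BigSunflower ys = ∃ λ zs → zs ⊆ˡ ys × length zs ≡ suc t × AllPairs (MeetIn K) zs

  -- The sunflower is sought within one class of equal profile. Its t + 1 petals serve twice: they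
  -- outnumber every clique, because t ≥ k + 1, and they exceed t as `big-sunflower-kernel` demands.
  apex-or-bounded : ∀ {d b ys} (v₀ : Fin m) (lenT : length K + d ≡ t) → HasApex v₀ lenT → 1 ≤ d → Above K ys → Degree≤ b K ys →
    length ys ≤ flower-bound d k t b ⊎ (∃ Apex × BigSunflower ys)
  apex-or-bounded {d} {b} {ys} v₀ lenT apex 1≤d ab deg =
    subst (λ n → length ys ≤ flower-bound d n t b ⊎ (∃ Apex × BigSunflower ys)) lenK
      (Sum.map₁ (flower-bound-≥ d (length K) t b) (uniform-bound profile (keys d (length K)) ys (distinct ab) class))
    where
    open Uniform v₀ lenT
    class : ∀ zs → Unique zs → zs ⊆ˡ ys → (∀ {κ S T} → κ ∈ˡ keys d (length K) → S ∈ˡ zs → T ∈ˡ zs → profile κ S ≡ profile κ T) →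
      length zs ≤ suc t * d * b ⊎ (∃ Apex × BigSunflower ys)
    class zs uzs zs⊆ uni with sunflower (suc t) uK lenT (above uzs (inF ab ∘ zs⊆) (kernel ab ∘ zs⊆)) (λ f∉ sub → deg f∉ (zs⊆ ∘ sub))
    ... | inj₁ le = inj₁ le
    ... | inj₂ (ws , ws⊆ , lenws , meet) = inj₂ (apex (record
            { zs⊆F = inF ab ∘ zs⊆ ∘ ws⊆ ; K⊑ = kernel ab ∘ zs⊆ ∘ ws⊆ ; meet = meet ; big = big
            ; uniform = λ {κ} S∈ T∈ → uni (∈-keys κ) (ws⊆ S∈) (ws⊆ T∈) }) , ws , zs⊆ ∘ ws⊆ , lenws , meet)
      where
      big : 2 + k ≤ length ws
      big = ≤-trans (s≤s (≤-trans (≤-trans (≤-reflexive (+-comm 1 k)) (≤-trans (+-monoʳ-≤ k 1≤d) (≤-reflexive (cong (_+ d) (sym lenK))))) (≤-reflexive lenT))) (≤-reflexive (sym lenws))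

-- Upper bounds

-- Two distinct members would share a k-clique, and with t = k each of them equals it.
upper₁ : ∀ {k m} (X : System (2 + k) k m) → size X ≤ 1
upper₁ X = unique-constant-length-≤1 (unique X) same
  where
  same : ∀ {S T} → S ∈ˡ F X → T ∈ˡ F X → S ≡ T
  same {S} {T} S∈ T∈ with ≡-dec Bool._≟_ S T
  ... | yes eq = eq
  ... | no neq with HasClique⇒clique (H X) (pairwise X S∈ T∈ neq)
  ...   | W , cl , sub , len = subset-determined (clique-unique (H X) cl)
            (proj₁ ∘ x∈p∩q⁻ S T ∘ sub) (proj₂ ∘ x∈p∩q⁻ S T ∘ sub)
            (≤-reflexive (trans (sizes X S∈) (sym len))) (≤-reflexive (trans (sizes X T∈) (sym len)))

module _ {k m : ℕ} (X : System (2 + k) (suc k) m) where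
  open Facts X

  module _ {K : List (Fin m)} (clK : Clique (H X) K) (lenK : length K ≡ k) where
    open Kernel X clK lenK

    size≤ : ∀ {S} → S ∈ˡ F X → ∣ S ∣ ≤ suc (length K)
    size≤ S∈ = ≤-reflexive (trans (sizes X S∈) (cong suc (sym lenK)))

    completion : ∀ {S a} → S ∈ˡ F X → K ⊑ S → a ∈ S → a ∉ˡ K → ∀ {x} → x ∈ S → x ∈ˡ a ∷ K
    completion S∈ K⊑S a∈ a∉ = ⊑-tight (∷-unique a∉ uK) (∷-⊑ a∈ K⊑S) (size≤ S∈)

    -- A k-clique W of S = K + a dominates b; it contains a, as otherwise it would lie in T and form
    -- a (k+1)-clique with b. So W lies in a + N, where N is the set of neighbours of a in K. But a
    -- + N is itself a clique of S and has at most k vertices, so W = a + N.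
    joint-neighbours : ∀ {S T a b} → S ∈ˡ F X → T ∈ˡ F X → S ≢ T → K ⊑ S → K ⊑ T → a ∈ S → a ∉ˡ K → b ∈ T → b ∉ˡ K →
      (∀ {z} → z ∈ˡ K → a ~ z → b ~ z) × k ≤ suc (length (filter (adj? (H X) a) K))
    joint-neighbours {S} {T} {a} {b} S∈ T∈ S≢T K⊑S K⊑T a∈ a∉ b∈ b∉ with dominated S∈ b∉S
      where
      b∉S : b ∉ S
      b∉S b∈S = S≢T (subset-determined (∷-unique b∉ uK) (∷-⊑ b∈S K⊑S) (∷-⊑ b∈ K⊑T) (size≤ S∈) (size≤ T∈))
    ... | W , clW , W⊑S , k≤W , b~W = (λ z∈ az → b~W (aN⊆W (there (N⁺ z∈ az)))) , ≤-trans k≤W W≤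
      where
      N? = adj? (H X) a
      N = filter N? K
      N⁻ : ∀ {z} → z ∈ˡ N → z ∈ˡ K × a ~ z
      N⁻ = ∈-filter⁻ N? {xs = K}
      N⁺ : ∀ {z} → z ∈ˡ K → a ~ z → z ∈ˡ N
      N⁺ = ∈-filter⁺ N?
      uN = Unique.filter⁺ N? uK
      a∈W : a ∈ˡ W
      a∈W with a ∈ˡ? W
      ... | yes a∈W = a∈W
      ... | no a∉W = contradiction (free-bound T∈ (clique-∷ (H X) b~W clW)
              (∷-⊑ b∈ λ w∈ → K⊑T (∈∷⁻ (completion S∈ K⊑S a∈ a∉ (W⊑S w∈)) λ { refl → a∉W w∈ }))) (<⇒≱ (s≤s k≤W))
      W⊆aN : W ⊆ˡ a ∷ N
      W⊆aN {w} w∈ with completion S∈ K⊑S a∈ a∉ (W⊑S w∈)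
      ... | here p = here p
      ... | there w∈K = there (N⁺ w∈K (clique-lookup (H X) clW a∈W w∈ λ { refl → a∉ w∈K }))
      W≤ : length W ≤ suc (length N)
      W≤ = unique-length-≤ (clique-unique (H X) clW) W⊆aN
      aN≤W : suc (length N) ≤ length W
      aN≤W = ≤-trans (free-bound S∈ (clique-∷ (H X) (proj₂ ∘ N⁻) (sub-clique uN (proj₁ ∘ N⁻))) (∷-⊑ a∈ (K⊑S ∘ proj₁ ∘ N⁻))) k≤W
      aN⊆W : a ∷ N ⊆ˡ W
      aN⊆W = unique-tight (clique-unique (H X) clW) W⊆aN aN≤W

    -- The k-clique shared by S and U avoids z, so it lies in a + (K - z), which has only k
    -- vertices, and fills it.
    crossing : ∀ {S U a z} → S ∈ˡ F X → U ∈ˡ F X → K ⊑ S → a ∈ S → a ∉ˡ K → (z∈K : z ∈ˡ K) → z ∉ U →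
      a ∈ U × WithApex.K′ z∈K ⊑ U × (∀ {v} → v ∈ˡ WithApex.K′ z∈K → a ~ v)
    crossing {S} {U} {a} {z} S∈ U∈ K⊑S a∈ a∉ z∈K z∉U
      with HasClique⇒clique (H X) (pairwise X S∈ U∈ (λ { refl → z∉U (K⊑S z∈K) }))
    ... | W , clW , W⊑ , lenW = W⊑U (tight (here refl)) , W⊑U ∘ tight ∘ there ,
            λ v∈ → clique-lookup (H X) clW (tight (here refl)) (tight (there v∈)) λ { refl → a∉ (proj₁ (K′⁻ v∈)) }
      where
      open WithApex z∈K
      W⊑S : W ⊑ S
      W⊑S = proj₁ ∘ x∈p∩q⁻ S U ∘ W⊑
      W⊑U : W ⊑ U
      W⊑U = proj₂ ∘ x∈p∩q⁻ S U ∘ W⊑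
      W⊆ : W ⊆ˡ a ∷ K′
      W⊆ w∈ with completion S∈ K⊑S a∈ a∉ (W⊑S w∈)
      ... | here p = here p
      ... | there w∈K = there (∈-filter⁺ (λ v → ¬? (v Fin.≟ z)) w∈K λ { refl → z∉U (W⊑U w∈) })
      tight : a ∷ K′ ⊆ˡ W
      tight = unique-tight (clique-unique (H X) clW) W⊆ (≤-trans 1+K′≤k (≤-reflexive (sym lenW)))

    -- If K lies in U, the three completing vertices and the k - 1 neighbours of a in K form a
    -- (k+2)-clique. If z in K is missing from U, then U contains a, b and K - z, which form a
    -- (k+1)-clique.
    no-third : ∀ {S T U} → S ∈ˡ F X → T ∈ˡ F X → U ∈ˡ F X → S ≢ T → S ≢ U → T ≢ U → K ⊑ S → K ⊑ T → ⊥
    no-third {S} {T} {U} S∈ T∈ U∈ S≢T S≢U T≢U K⊑S K⊑T =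
      let (a , a∈ , a∉) = outside uK K⊑S S∈ len
          (b , b∈ , b∉) = outside uK K⊑T T∈ len
      in main a∈ a∉ b∈ b∉ (all? (_∈? U) K)
      where
      len : length K + 1 ≡ suc k
      len = trans (+-comm (length K) 1) (cong suc lenK)
      adjacent : ∀ {S T a b} → S ∈ˡ F X → T ∈ˡ F X → S ≢ T → K ⊑ S → K ⊑ T → a ∈ S → a ∉ˡ K → b ∈ T → b ∉ˡ K → a ~ b
      adjacent = completions-adjacent uK (cong suc lenK)
      main : ∀ {a b} → a ∈ S → a ∉ˡ K → b ∈ T → b ∉ˡ K → Dec (All (_∈ U) K) → ⊥
      main {a} {b} a∈ a∉ b∈ b∉ (yes all) = over (outside uK K⊑U U∈ len) (joint-neighbours S∈ T∈ S≢T K⊑S K⊑T a∈ a∉ b∈ b∉)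
        where
        K⊑U : K ⊑ U
        K⊑U = All.lookup all
        N : List (Fin m)
        N = filter (adj? (H X) a) K
        N⁻ : ∀ {z} → z ∈ˡ N → z ∈ˡ K × a ~ z
        N⁻ = ∈-filter⁻ (adj? (H X) a) {xs = K}
        over : (∃ λ c → c ∈ U × c ∉ˡ K) → (∀ {z} → z ∈ˡ K → a ~ z → b ~ z) × k ≤ suc (length N) → ⊥
        over (c , c∈ , c∉) (ab , k≤) = contradiction (clique-bound (clique-∷ (H X) a~ (clique-∷ (H X) b~ (clique-∷ (H X) c~ clN)))) (<⇒≱ (s≤s (s≤s k≤)))
          where
          a~ : ∀ {z} → z ∈ˡ b ∷ c ∷ N → a ~ z
          a~ (here refl) = adjacent S∈ T∈ S≢T K⊑S K⊑T a∈ a∉ b∈ b∉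
          a~ (there (here refl)) = adjacent S∈ U∈ S≢U K⊑S K⊑U a∈ a∉ c∈ c∉
          a~ (there (there z∈)) = proj₂ (N⁻ z∈)
          b~ : ∀ {z} → z ∈ˡ c ∷ N → b ~ z
          b~ (here refl) = adjacent T∈ U∈ T≢U K⊑T K⊑U b∈ b∉ c∈ c∉
          b~ (there z∈) = ab (proj₁ (N⁻ z∈)) (proj₂ (N⁻ z∈))
          c~ : ∀ {z} → z ∈ˡ N → c ~ z
          c~ z∈ = proj₁ (joint-neighbours S∈ U∈ S≢U K⊑S K⊑U a∈ a∉ c∈ c∉) (proj₁ (N⁻ z∈)) (proj₂ (N⁻ z∈))
          clN : Clique (H X) N
          clN = sub-clique (Unique.filter⁺ (adj? (H X) a) uK) (proj₁ ∘ N⁻)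
      main {a} {b} a∈ a∉ b∈ b∉ (no ¬all) = cross (find (All.¬All⇒Any¬ (_∈? U) K ¬all))
        where
        cross : (∃ λ z → z ∈ˡ K × z ∉ U) → ⊥
        cross (z , z∈K , z∉U) = over (crossing S∈ U∈ K⊑S a∈ a∉ z∈K z∉U) (crossing T∈ U∈ K⊑T b∈ b∉ z∈K z∉U)
          where
          open WithApex z∈K
          over : a ∈ U × K′ ⊑ U × (∀ {v} → v ∈ˡ K′ → a ~ v) → b ∈ U × K′ ⊑ U × (∀ {v} → v ∈ˡ K′ → b ~ v) → ⊥
          over (a∈U , K′⊑U , a~) (b∈U , _ , b~) = contradiction
            (free-bound U∈ (clique-∷ (H X) a~′ (clique-∷ (H X) b~ clK′)) (∷-⊑ a∈U (∷-⊑ b∈U K′⊑U))) (<⇒≱ (s≤s k≤1+K′))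
            where
            a~′ : ∀ {v} → v ∈ˡ b ∷ K′ → a ~ v
            a~′ (here refl) = adjacent S∈ T∈ S≢T K⊑S K⊑T a∈ a∉ b∈ b∉
            a~′ (there v∈) = a~ v∈

  upper₂ : size X ≤ 2
  upper₂ with F X in eq | unique X
  ... | [] | _ = z≤n
  ... | _ ∷ [] | _ = s≤s z≤n
  ... | _ ∷ _ ∷ [] | _ = s≤s (s≤s z≤n)
  ... | S ∷ T ∷ U ∷ _ | (S≢T ∷ S≢U ∷ _) ∷ (T≢U ∷ _) ∷ _ =
    let S∈ = subst (S ∈ˡ_) (sym eq) (here refl)
        T∈ = subst (T ∈ˡ_) (sym eq) (there (here refl))
        U∈ = subst (U ∈ˡ_) (sym eq) (there (there (here refl)))
        (K , cl , sub , len) = HasClique⇒clique (H X) (pairwise X S∈ T∈ S≢T)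
    in ⊥-elim (no-third cl len S∈ T∈ U∈ S≢T S≢U T≢U (proj₁ ∘ x∈p∩q⁻ S T ∘ sub) (proj₂ ∘ x∈p∩q⁻ S T ∘ sub))

-- Supplies the default vertex for `nth`; the kernel is not empty because r ≥ 3.
a-vertex : ∀ {m k} {K : List (Fin m)} → length K ≡ suc k → Fin m
a-vertex {K = v ∷ _} _ = v

-- From here on r = 3 + k in (3) and (4), so kernels have k + 1 vertices and the codegree bound is 2
-- + k. The first term covers the absence of a large sunflower, the second a link with few petals.
bound₃ : ℕ → ℕ
bound₃ k = flower-bound 2 (suc k) (3 + k) (2 + k) + 5 * (2 + k)

module _ {k m : ℕ} (X : System (3 + k) (3 + k) m) where
  open Facts X
  open Link X

  upper₃ : size X ≤ suc ((3 + k) ^ suc k * bound₃ k) ⊎ suc k + size X * 2 ≤ m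
  upper₃ = kernel-bound class
    where
    class : ∀ {K ys} → Clique (H X) K → length K ≡ suc k → Above K ys → length ys ≤ bound₃ k ⊎ suc k + size X * 2 ≤ m
    class {K} {ys} cl lenK ab = conclude (apex-or-bounded v₀ lenT (apex₂ v₀ lenT) (s≤s z≤n) ab
        λ f∉ _ ab′ → codegree (∷-unique f∉ uK) ab′ (cong (2 +_) lenK))
      where
      open Kernel X cl lenK
      v₀ = a-vertex {K = K} lenK
      lenT : length K + 2 ≡ 3 + k
      lenT = trans (+-comm (length K) 2) (cong (2 +_) lenK)
      conclude : length ys ≤ flower-bound 2 (suc k) (3 + k) (2 + k) ⊎ (∃ Apex × BigSunflower ys) → _
      conclude (inj₁ le) = inj₁ (m≤n⇒m≤n+o (5 * (2 + k)) le)
      conclude (inj₂ ((p , apex) , zs , zs⊆ , lenzs , meet)) = finish (Pairs.link-matching (apex-link apex all-above) lenT)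
        where
        -- `zs` has t + 1 members, so K lies in all of `F X`, and the link is formed over the whole
        -- family instead of `ys`.
        all-above : Above K (F X)
        all-above = above (unique X) id (big-sunflower-kernel cl lenK (inF ab ∘ zs⊆) (kernel ab ∘ zs⊆) meet (≤-reflexive (sym lenzs)))
        finish : size X ≤ 5 * (2 + k) ⊎ length K + size X * 2 ≤ m → length ys ≤ bound₃ k ⊎ suc k + size X * 2 ≤ m
        finish (inj₁ le) = inj₁ (m≤n⇒m≤o+n _ (≤-trans (unique-length-≤ (distinct ab) (inF ab)) le))
        finish (inj₂ le) = inj₂ (≤-trans (≤-reflexive (cong (_+ size X * 2) (sym lenK))) le)

bound₄ : ℕ → ℕ
bound₄ k = flower-bound 3 (suc k) (4 + k) (2 + k) + 6 * (2 + k)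

module _ {k m : ℕ} (X : System (3 + k) (4 + k) m) where
  open Facts X
  open Link X

  upper₄ : size X ≤ suc ((4 + k) ^ suc k * (m * bound₄ k))
  upper₄ = [ id , ⊥-elim ]′ (kernel-bound {Q = ⊥} class)
    where
    class : ∀ {K ys} → Clique (H X) K → length K ≡ suc k → Above K ys → length ys ≤ m * bound₄ k ⊎ ⊥
    class {K} {ys} cl lenK ab = conclude (apex-or-bounded v₀ lenT (apex₃ v₀ lenT) (s≤s z≤n) ab degree)
      where
      open Kernel X cl lenK
      v₀ = a-vertex {K = K} lenK
      lenT : length K + 3 ≡ 4 + k
      lenT = trans (+-comm (length K) 3) (cong (3 +_) lenK)
      -- With K and one petal vertex fixed, a second one can be chosen in m ways, and the codegree
      -- bound then applies; hence the sunflower bound is linear in m.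
      degree : Degree≤ (m * (2 + k)) K ys
      degree f∉ _ ab′ = ≤-trans
        (extend 1 (∷-unique f∉ uK) ab′ (≤-trans (≤-reflexive (trans (sym (+-suc (length K) 1)) (trans (+-comm (length K) 2) (cong (2 +_) lenK)))) (n≤1+n _))
          (λ u _ len ab″ → codegree u ab″ (cong suc (trans len (cong (2 +_) lenK)))))
        (≤-reflexive (cong (_* (2 + k)) (*-identityʳ m)))
      conclude : length ys ≤ flower-bound 3 (suc k) (4 + k) (m * (2 + k)) ⊎ (∃ Apex × BigSunflower ys) → _
      conclude (inj₁ le) = inj₁ (≤-trans le (≤-trans (≤-reflexive (flower-bound-* 3 (suc k) (4 + k) m (2 + k)))
        (*-monoʳ-≤ m (m≤m+n _ (6 * (2 + k))))))
      conclude (inj₂ ((p , apex) , _)) = inj₁ (≤-trans (Triples.link-linear (apex-link apex ab) lenT) (*-monoʳ-≤ m (m≤n+m (6 * (2 + k)) _)))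

upper₅ : ∀ {k n m} (X : System (2 + k) (k + n) m) → size X ≤ suc ((k + n) ^ k * (m ^ n * 1))
upper₅ {k} {n} X = [ id , ⊥-elim ]′ (kernel-bound {Q = ⊥} λ cl lenK ab → inj₁ (extend n (clique-unique (H X) cl) ab (≤-reflexive (cong (_+ n) lenK))
    λ u _ len ab′ → above-full u ab′ (trans len (trans (cong (n +_) lenK) (+-comm n k)))))
  where open Facts X

module _ {n m : ℕ} (X : System 3 (4 + n) m) where
  open Facts X
  open Link X

  -- For r = 3 the whole graph is triangle-free and every member is independent, so any fixed set L
  -- gives a link. A vertex dominating y in T - L lies outside L, because L lies in the independent
  -- set T. Fixing n + 1 vertices leaves petals of size three, and 12 is 6 * suc k for k = 1.
  upper₆ : size X ≤ suc ((4 + n) ^ 1 * (m ^ n * (m * 12)))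
  upper₆ = [ id , ⊥-elim ]′ (kernel-bound {Q = ⊥} λ cl lenK ab → inj₁ (extend n (clique-unique (H X) cl) ab (fits lenK)
      λ u _ len ab′ → Triples.link-linear (link u ab′) (trans (cong (_+ 3) (trans len (trans (cong (n +_) lenK) (+-comm n 1)))) (cong suc (+-comm n 3)))))
    where
    fits : ∀ {l} → l ≡ 1 → l + n ≤ 4 + n
    fits refl = s≤s (m≤n+m n 3)
    independent : ∀ {S x y} → S ∈ˡ F X → x ∈ S → y ∈ S → ¬ x ~ y
    independent S∈ x∈ y∈ e = contradiction (free-bound S∈ ((e ∷ []) ∷ [] ∷ []) (∷-⊑ x∈ (∷-⊑ y∈ λ ()))) λ { (s≤s ()) }
    link : ∀ {L ys} → Unique L → Above L ys → TriangleFreeLink L ys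
    link {L} {ys} u ab = record
      { fresh = u ; sets = ab ; independent = λ S∈ x∈ _ y∈ _ → independent (inF ab S∈) x∈ y∈ ; dominating = dominating
      ; no-triangle = λ _ _ _ xy yz xz → contradiction (clique-bound ((xy ∷ xz ∷ []) ∷ (yz ∷ []) ∷ [] ∷ [])) λ { (s≤s (s≤s ())) } }
      where
      dominating : ∀ {S T y} → S ∈ˡ ys → T ∈ˡ ys → y ∈ T → y ∉ˡ L → y ∉ S → ∃ λ x → x ∈ S × x ∉ˡ L × x ~ y
      dominating S∈ T∈ y∈T _ y∉S with dominated (inF ab S∈) y∉S
      ... | w ∷ _ , _ , W⊑S , _ , y~W = w , W⊑S (here refl) ,
              (λ w∈L → independent (inF ab T∈) y∈T (kernel ab T∈ w∈L) (y~W (here refl))) , flip (H X) (y~W (here refl))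

-- Lower bounds

restrict : ∀ {m} → List (Fin (suc m)) → List (Fin m)
restrict W = filter (λ x → suc x ∈ˡ? W) (allFin _)

module _ {m : ℕ} {W : List (Fin (suc m))} where

  ∈-restrict⁻ : ∀ {x} → x ∈ˡ restrict W → suc x ∈ˡ W
  ∈-restrict⁻ x∈ = proj₂ (∈-filter⁻ (λ x → suc x ∈ˡ? W) {xs = allFin _} x∈)

  restrict-unique : Unique (restrict W)
  restrict-unique = Unique.filter⁺ (λ x → suc x ∈ˡ? W) (Unique.allFin⁺ m)

  length-restrict : Unique W → length W ≤ suc (length (restrict W))
  length-restrict uW = ≤-trans (unique-length-≤ uW W⊆) (≤-reflexive (cong suc (length-map suc (restrict W))))
    where
    W⊆ : W ⊆ˡ zero ∷ map suc (restrict W)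
    W⊆ {zero} _ = here refl
    W⊆ {suc x} x∈ = there (∈-map⁺ suc (∈-filter⁺ (λ x → suc x ∈ˡ? W) (∈-allFin x) x∈))

addVertex : ∀ {m} → (Fin m → Bool) → Graph m → Graph (suc m)
addVertex {m} g H = record { adj = adj′ ; sym = sym′ ; irrefl = irrefl′ }
  where
  adj′ : Fin (suc m) → Fin (suc m) → Bool
  adj′ zero zero = false
  adj′ zero (suc j) = g j
  adj′ (suc i) zero = g i
  adj′ (suc i) (suc j) = adj H i j
  sym′ : ∀ i j → adj′ i j ≡ adj′ j i
  sym′ zero zero = refl
  sym′ zero (suc j) = refl
  sym′ (suc i) zero = refl
  sym′ (suc i) (suc j) = adj-sym H i j
  irrefl′ : ∀ i → adj′ i i ≡ false
  irrefl′ zero = refl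
  irrefl′ (suc i) = irrefl H i

module _ {m : ℕ} {b : Bool} {G : List (Subset m)} where

  ∈-extend⁻ : ∀ {S} → S ∈ˡ map (b ∷_) G → ∃ λ S′ → S′ ∈ˡ G × S ≡ b ∷ S′
  ∈-extend⁻ = ∈-map⁻ (b ∷_)

  extend-unique : Unique G → Unique (map (b ∷_) G)
  extend-unique = Unique.map⁺ Vec.∷-injectiveʳ

-- The new vertex is joined to everything and put into every set, so all clique sizes in the
-- conditions rise by exactly one, as do r, t and m.
cone : ∀ {k t m} → System (2 + k) t m → System (3 + k) (suc t) (suc m)
cone {k} {t} {m} X = record
  { H = C ; F = map (true ∷_) (F X) ; noKr = noKr′ ; maxFree = maxFree′ ; pairwise = pairwise′
  ; unique = extend-unique (unique X) ; sizes = λ S∈ → case ∈-extend⁻ S∈ of λ { (_ , S′∈ , refl) → cong suc (sizes X S′∈) } }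
  where
  C = addVertex (λ _ → true) (H X)
  shrink : ∀ {n S b} → HasClique C (b ∷ S) (suc n) → HasClique (H X) S n
  shrink c with HasClique⇒clique C c
  ... | W , cl , W⊑ , len = clique⇒HasClique (H X) {W = restrict W}
    (allPairs-∈ restrict-unique λ x∈ y∈ x≢y → clique-lookup C cl (∈-restrict⁻ x∈) (∈-restrict⁻ y∈) (x≢y ∘ Fin.suc-injective))
    (λ x∈ → case W⊑ (∈-restrict⁻ x∈) of λ { (thereᵛ x∈S) → x∈S })
    (s≤s⁻¹ (≤-trans (≤-reflexive (sym len)) (length-restrict (clique-unique C cl))))
  grow : ∀ {n S} → HasClique (H X) S n → HasClique C (true ∷ S) (suc n)
  grow c with HasClique⇒clique (H X) c
  ... | W , cl , W⊑ , len = clique⇒HasClique C {W = zero ∷ map suc W}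
    (clique-∷ C (λ w∈ → case ∈-map⁻ suc w∈ of λ { (_ , _ , refl) → refl }) (AllPairs.map⁺ cl))
    (∷-⊑ hereᵛ λ w∈ → case ∈-map⁻ suc w∈ of λ { (_ , v∈ , refl) → thereᵛ (W⊑ v∈) })
    (s≤s (≤-reflexive (trans (sym len) (sym (length-map suc W)))))
  noKr′ : ¬ HasClique C ⊤ (3 + k)
  noKr′ c = noKr X (shrink c)
  maxFree′ : ∀ {S} → S ∈ˡ map (true ∷_) (F X) → MaximallyFree C (2 + k) S
  maxFree′ S∈ with ∈-extend⁻ S∈
  ... | S′ , S′∈ , refl = proj₁ (maxFree X S′∈) ∘ shrink , λ where
    zero v∉ → contradiction hereᵛ v∉
    (suc v) v∉ → grow (proj₂ (maxFree X S′∈) v (v∉ ∘ thereᵛ))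
  pairwise′ : ∀ {S T} → S ∈ˡ map (true ∷_) (F X) → T ∈ˡ map (true ∷_) (F X) → S ≢ T → HasClique C (S ∩ T) (suc k)
  pairwise′ S∈ T∈ S≢T with ∈-extend⁻ S∈ | ∈-extend⁻ T∈
  ... | S′ , S′∈ , refl | T′ , T′∈ , refl = grow (pairwise X S′∈ T′∈ (S≢T ∘ cong (true ∷_)))

cones : ∀ n {t m} → System 3 t m → System (3 + n) (n + t) (n + m)
cones zero X = X
cones (suc n) X = cone (cones n X)

size-cones : ∀ n {t m} (X : System 3 t m) → size (cones n X) ≡ size X
size-cones zero X = refl
size-cones (suc n) X = trans (length-map (true ∷_) (F (cones n X))) (size-cones n X)

-- An `r`-system for r = 3 without the requirement that members meet; `isolate` restores it, since
-- an isolated vertex lies in every maximal independent set.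
record MaximalIndependent (t m n : ℕ) : Set where
  field
    G           : Graph m
    fam         : List (Subset m)
    no-triangle : ∀ {x y z} → Adj G x y → Adj G y z → Adj G x z → ⊥
    independent : ∀ {S x y} → S ∈ˡ fam → x ∈ S → y ∈ S → ¬ Adj G x y
    maximal     : ∀ {S v} → S ∈ˡ fam → v ∉ S → ∃ λ x → x ∈ S × Adj G v x
    distinct    : Unique fam
    fam-size    : ∀ {S} → S ∈ˡ fam → ∣ S ∣ ≡ t
    count       : length fam ≡ n

record Centred (t m n : ℕ) : Set where
  field
    base   : MaximalIndependent t m n
    centre : Fin m
    common : ∀ {S} → S ∈ˡ MaximalIndependent.fam base → centre ∈ S

isolate : ∀ {t m n} → MaximalIndependent t m n → Centred (suc t) (suc m) n
isolate {t} {m} {n} M = record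
  { base = record
    { G = C ; fam = map (true ∷_) fam ; no-triangle = λ {x} {y} {z} → no-triangle′ {x} {y} {z} ; independent = independent′ ; maximal = maximal′
    ; distinct = extend-unique distinct
    ; fam-size = λ S∈ → case ∈-extend⁻ S∈ of λ { (_ , S′∈ , refl) → cong suc (fam-size S′∈) }
    ; count = trans (length-map _ fam) count }
  ; centre = zero
  ; common = λ S∈ → case ∈-extend⁻ S∈ of λ { (_ , _ , refl) → hereᵛ } }
  where
  open MaximalIndependent M
  C = addVertex (λ _ → false) G
  no-triangle′ : ∀ {x y z} → Adj C x y → Adj C y z → Adj C x z → ⊥
  no-triangle′ {suc _} {suc _} {suc _} xy yz xz = no-triangle xy yz xz
  no-triangle′ {zero} {zero} () _ _
  no-triangle′ {zero} {suc _} () _ _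
  no-triangle′ {suc _} {zero} () _ _
  no-triangle′ {suc _} {suc _} {zero} _ () _
  independent′ : ∀ {S x y} → S ∈ˡ map (true ∷_) fam → x ∈ S → y ∈ S → ¬ Adj C x y
  independent′ S∈ x∈ y∈ with ∈-extend⁻ S∈
  independent′ _ hereᵛ hereᵛ | _ , _ , refl = λ ()
  independent′ _ hereᵛ (thereᵛ _) | _ , _ , refl = λ ()
  independent′ _ (thereᵛ _) hereᵛ | _ , _ , refl = λ ()
  independent′ _ (thereᵛ x∈) (thereᵛ y∈) | _ , S′∈ , refl = independent S′∈ x∈ y∈
  maximal′ : ∀ {S v} → S ∈ˡ map (true ∷_) fam → v ∉ S → ∃ λ x → x ∈ S × Adj C v x
  maximal′ {v = v} S∈ v∉ with ∈-extend⁻ S∈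
  maximal′ {v = zero} _ v∉ | _ , _ , refl = contradiction hereᵛ v∉
  maximal′ {v = suc v} _ v∉ | _ , S′∈ , refl = let (x , x∈ , e) = maximal S′∈ (v∉ ∘ thereᵛ) in suc x , thereᵛ x∈ , e

-- Padding to the exact number of vertices: the new vertex joins no set, and every set dominates it
-- through the centre. Having a single neighbour, it lies in no triangle.
leaf : ∀ {t m n} → Centred t m n → Centred t (suc m) n
leaf {t} {m} {n} M = record
  { base = record
    { G = C ; fam = map (false ∷_) fam ; no-triangle = λ {x} {y} {z} → no-triangle′ {x} {y} {z} ; independent = independent′ ; maximal = maximal′
    ; distinct = extend-unique distinct
    ; fam-size = λ S∈ → case ∈-extend⁻ S∈ of λ { (_ , S′∈ , refl) → fam-size S′∈ }
    ; count = trans (length-map _ fam) count }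
  ; centre = suc centre
  ; common = λ S∈ → case ∈-extend⁻ S∈ of λ { (_ , S′∈ , refl) → thereᵛ (common S′∈) } }
  where
  open Centred M
  open MaximalIndependent base
  C = addVertex (λ x → does (x Fin.≟ centre)) G
  is-centre : ∀ {x} → does (x Fin.≟ centre) ≡ true → x ≡ centre
  is-centre {x} e with x Fin.≟ centre
  ... | yes p = p
  collapse : ∀ {x y} → does (x Fin.≟ centre) ≡ true → does (y Fin.≟ centre) ≡ true → ¬ Adj G x y
  collapse ex ey e = adj⇒≢ G e (trans (is-centre ex) (sym (is-centre ey)))
  no-triangle′ : ∀ {x y z} → Adj C x y → Adj C y z → Adj C x z → ⊥
  no-triangle′ {suc _} {suc _} {suc _} xy yz xz = no-triangle xy yz xz
  no-triangle′ {zero} {suc _} {suc _} xy yz xz = collapse xy xz yz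
  no-triangle′ {suc _} {zero} {suc _} xy yz xz = collapse xy yz xz
  no-triangle′ {suc _} {suc _} {zero} xy yz xz = collapse xz yz xy
  no-triangle′ {zero} {zero} () _ _
  no-triangle′ {zero} {suc _} {zero} _ _ ()
  no-triangle′ {suc _} {zero} {zero} _ () _
  independent′ : ∀ {S x y} → S ∈ˡ map (false ∷_) fam → x ∈ S → y ∈ S → ¬ Adj C x y
  independent′ S∈ x∈ y∈ with ∈-extend⁻ S∈
  independent′ _ (thereᵛ x∈) (thereᵛ y∈) | _ , S′∈ , refl = independent S′∈ x∈ y∈
  maximal′ : ∀ {S v} → S ∈ˡ map (false ∷_) fam → v ∉ S → ∃ λ x → x ∈ S × Adj C v x
  maximal′ {v = v} S∈ v∉ with ∈-extend⁻ S∈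
  maximal′ {v = zero} _ v∉ | _ , S′∈ , refl = suc centre , thereᵛ (common S′∈) , self
    where
    self : does (centre Fin.≟ centre) ≡ true
    self with centre Fin.≟ centre
    ... | yes _ = refl
    ... | no neq = contradiction refl neq
  maximal′ {v = suc v} _ v∉ | _ , S′∈ , refl = let (x , x∈ , e) = maximal S′∈ (v∉ ∘ thereᵛ) in suc x , thereᵛ x∈ , e

leaves : ∀ j {t m n} → Centred t m n → Centred t (j + m) n
leaves zero M = M
leaves (suc j) M = leaf (leaves j M)

centred-system : ∀ {t m n} → Centred t m n → Σ (System 3 t m) λ X → size X ≡ n
centred-system M = record
  { H = G ; F = fam
  ; noKr = λ c → case HasClique⇒clique G c of λ { (_ ∷ _ ∷ _ ∷ [] , (xy ∷ xz ∷ []) ∷ (yz ∷ []) ∷ _ , _ , _) → no-triangle xy yz xz }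
  ; maxFree = λ {S} S∈ →
      (λ c → case HasClique⇒clique G c of λ { (_ ∷ _ ∷ [] , (e ∷ []) ∷ _ , sub , _) → independent S∈ (sub (here refl)) (sub (there (here refl))) e }) ,
      (λ v v∉ → let (x , x∈ , e) = maximal S∈ v∉ in
        clique⇒HasClique G {W = v ∷ x ∷ []} ((e ∷ []) ∷ [] ∷ [])
          (∷-⊑ (x∈p∪q⁺ {p = S} (inj₂ (x∈⁅x⁆ v))) (∷-⊑ (x∈p∪q⁺ (inj₁ x∈)) λ ())) ≤-refl)
  ; pairwise = λ S∈ T∈ _ → clique⇒HasClique G {W = centre ∷ []} ([] ∷ []) (∷-⊑ (x∈p∩q⁺ (common S∈ , common T∈)) λ ()) ≤-refl
  ; unique = distinct ; sizes = fam-size } , count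
  where
  open Centred M
  open MaximalIndependent base

build-system : ∀ k j {t m n} → MaximalIndependent t m n → Σ (System (3 + k) (k + suc t) (k + (j + suc m))) λ X → size X ≡ n
build-system k j M = let (X , eq) = centred-system (leaves j (isolate M)) in cones k X , trans (size-cones k X) eq

-- The graph has parts {e} × Fin n for e < k, and the x-th set takes the vertex lab x e from part e.
record Transversals (k n N : ℕ) : Set₁ where
  field
    R           : Fin k × Fin n → Fin k × Fin n → Set
    R?          : ∀ u v → Dec (R u v)
    R-sym       : ∀ {u v} → R u v → R v u
    no-loop     : ∀ {u} → ¬ R u u
    no-triangle : ∀ {u v w} → R u v → R v w → R u w → ⊥
    lab         : Fin N → Fin k → Fin n
    lab-inj     : ∀ {x y} → (∀ e → lab x e ≡ lab y e) → x ≡ y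
    independent : ∀ x e e′ → ¬ R (e , lab x e) (e′ , lab x e′)
    maximal     : ∀ x e {l} → l ≢ lab x e → ∃ λ e′ → R (e , l) (e′ , lab x e′)

does-true⁺ : {P : Set} (d : Dec P) → P → does d ≡ true
does-true⁺ (yes _) _ = refl
does-true⁺ (no ¬p) p = contradiction p ¬p

does-true⁻ : {P : Set} (d : Dec P) → does d ≡ true → P
does-true⁻ (yes p) _ = p

transversal-family : ∀ {k n N} → Transversals k n N → MaximalIndependent k (k * n) N
transversal-family {k} {n} {N} D = record
  { G = G ; fam = tabulate T
  ; no-triangle = λ xy yz xz → no-triangle (adj⁻ xy) (adj⁻ yz) (adj⁻ xz)
  ; independent = λ S∈ x∈ y∈ e → case ∈-tabulate⁻ S∈ of λ { (i , refl) → independent′ i x∈ y∈ e }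
  ; maximal = λ S∈ v∉ → case ∈-tabulate⁻ S∈ of λ { (i , refl) → maximal′ i v∉ }
  ; distinct = Unique.tabulate⁺ T-injective
  ; fam-size = λ S∈ → case ∈-tabulate⁻ S∈ of λ { (i , refl) → T-size i }
  ; count = length-tabulate T }
  where
  open Transversals D
  part : Fin (k * n) → Fin k × Fin n
  part = remQuot n
  G : Graph (k * n)
  G = record
    { adj = λ u v → does (R? (part u) (part v))
    ; sym = λ u v → does-⇔ (mk⇔ R-sym R-sym) (R? _ _) (R? _ _)
    ; irrefl = λ u → Bool.¬-not (no-loop ∘ does-true⁻ (R? _ _)) }
  adj⁻ : ∀ {u v} → Adj G u v → R (part u) (part v)
  adj⁻ = does-true⁻ (R? _ _)
  on? : ∀ i v → Dec (proj₂ (part v) ≡ lab i (proj₁ (part v)))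
  on? i v = proj₂ (part v) Fin.≟ lab i (proj₁ (part v))
  T : Fin N → Subset (k * n)
  T i = Vec.tabulate (λ v → does (on? i v))
  T⁺ : ∀ i {v} → proj₂ (part v) ≡ lab i (proj₁ (part v)) → v ∈ T i
  T⁺ i {v} eq = Vec.lookup⇒[]= v (T i) (trans (Vec.lookup∘tabulate _ v) (does-true⁺ (on? i v) eq))
  T⁻ : ∀ i {v} → v ∈ T i → proj₂ (part v) ≡ lab i (proj₁ (part v))
  T⁻ i {v} v∈ = does-true⁻ (on? i v) (trans (sym (Vec.lookup∘tabulate _ v)) (Vec.[]=⇒lookup v∈))
  vertex : Fin N → Fin k → Fin (k * n)
  vertex i e = combine e (lab i e)
  part-vertex : ∀ i e → part (vertex i e) ≡ (e , lab i e)
  part-vertex i e = Fin.remQuot-combine e (lab i e)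
  vertex∈ : ∀ i e → vertex i e ∈ T i
  vertex∈ i e = T⁺ i (trans (cong proj₂ (part-vertex i e)) (cong (lab i) (sym (cong proj₁ (part-vertex i e)))))
  independent′ : ∀ i {u v} → u ∈ T i → v ∈ T i → ¬ Adj G u v
  independent′ i {u} {v} u∈ v∈ e = independent i (proj₁ (part u)) (proj₁ (part v))
    (subst (λ l → R (proj₁ (part u) , lab i _) (proj₁ (part v) , l)) (T⁻ i v∈) (subst (λ l → R (proj₁ (part u) , l) (part v)) (T⁻ i u∈) (adj⁻ e)))
  maximal′ : ∀ i {v} → v ∉ T i → ∃ λ x → x ∈ T i × Adj G v x
  maximal′ i {v} v∉ = let (e′ , r) = maximal i (proj₁ (part v)) (v∉ ∘ T⁺ i) in
    vertex i e′ , vertex∈ i e′ , does-true⁺ (R? _ _) (subst (R (part v)) (sym (part-vertex i e′)) r)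
  T-injective : ∀ {i j} → T i ≡ T j → i ≡ j
  T-injective {i} {j} eq = lab-inj λ e → trans (sym (cong proj₂ (part-vertex i e)))
    (trans (T⁻ j (subst (vertex i e ∈_) eq (vertex∈ i e))) (cong (lab j) (cong proj₁ (part-vertex i e))))
  T-size : ∀ i → ∣ T i ∣ ≡ k
  T-size i = ≤-antisym
    (≤-trans (≤-reflexive (sym (length-members (T i)))) (≤-trans (unique-length-≤ (members-unique (T i)) (covered ∘ members-⊑ (T i))) (≤-reflexive (length-tabulate (vertex i)))))
    (≤-trans (≤-reflexive (sym (length-tabulate (vertex i))))
      (unique-⊑-length (Unique.tabulate⁺ λ {e} {e′} eq → trans (sym (cong proj₁ (part-vertex i e))) (trans (cong (proj₁ ∘ part) eq) (cong proj₁ (part-vertex i e′))))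
        (λ v∈ → case ∈-tabulate⁻ v∈ of λ { (e , refl) → vertex∈ i e })))
    where
    covered : ∀ {v} → v ∈ T i → v ∈ˡ tabulate (vertex i)
    covered {v} v∈ = subst (_∈ˡ tabulate (vertex i))
      (trans (cong (combine (proj₁ (part v))) (sym (T⁻ i v∈))) (Fin.combine-remQuot {k} n v)) (∈-tabulate⁺ (proj₁ (part v)))

-- The graph without vertices, with the empty set as its only member. After the isolated vertex and
-- the leaves it becomes a star whose centre is the only member.
trivial : Transversals 0 0 1
trivial = record
  { R = λ _ _ → ⊥ ; R? = λ _ _ → no λ () ; R-sym = λ () ; no-loop = λ () ; no-triangle = λ () ; lab = λ _ ()
  ; lab-inj = λ { {zero} {zero} _ → refl } ; independent = λ _ () ; maximal = λ _ () }

-- A single edge with its two endpoints as the maximal independent sets.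
edge : Transversals 1 2 2
edge = record
  { R = λ (_ , l) (_ , l′) → l ≢ l′ ; R? = λ (_ , l) (_ , l′) → ¬? (l Fin.≟ l′) ; R-sym = ≢-sym ; no-loop = λ neq → neq refl
  ; no-triangle = λ { {_ , l} {_ , l′} {_ , l″} → three l l′ l″ } ; lab = λ x _ → x ; lab-inj = λ eq → eq zero
  ; independent = λ _ _ _ neq → neq refl ; maximal = λ x e neq → e , neq }
  where
  three : (a b c : Fin 2) → a ≢ b → b ≢ c → a ≢ c → ⊥
  three zero zero _ p _ _ = p refl
  three (suc zero) (suc zero) _ p _ _ = p refl
  three zero (suc zero) zero _ _ r = r refl
  three zero (suc zero) (suc zero) _ q _ = q refl
  three (suc zero) zero zero _ q _ = q refl
  three (suc zero) zero (suc zero) _ _ r = r refl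

-- The complete bipartite graph minus a perfect matching; the members are the deleted edges.
crown : ∀ n → Transversals 2 n n
crown n = record
  { R = λ (e , l) (e′ , l′) → e ≢ e′ × l ≢ l′ ; R? = λ (e , l) (e′ , l′) → ¬? (e Fin.≟ e′) ×-dec ¬? (l Fin.≟ l′)
  ; R-sym = λ (p , q) → ≢-sym p , ≢-sym q ; no-loop = λ (p , _) → p refl
  ; no-triangle = λ { {e , _} {e′ , _} {e″ , _} (p , _) (q , _) (r , _) → Transversals.no-triangle edge {zero , e} {zero , e′} {zero , e″} p q r }
  ; lab = λ x _ → x ; lab-inj = λ eq → eq zero ; independent = λ _ _ _ (_ , q) → q refl ; maximal = maximal }
  where
  maximal : ∀ x (e : Fin 2) {l} → l ≢ x → ∃ λ e′ → e ≢ e′ × l ≢ x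
  maximal x zero neq = suc zero , (λ ()) , neq
  maximal x (suc zero) neq = zero , (λ ()) , neq

funToFin-cong : ∀ {m n} {f g : Fin m → Fin n} → (∀ i → f i ≡ g i) → funToFin f ≡ funToFin g
funToFin-cong {zero} eq = refl
funToFin-cong {suc m} eq = cong₂ combine (eq zero) (funToFin-cong (eq ∘ suc))

finToFun-injective : ∀ {m n} (x y : Fin (n ^ m)) → (∀ i → finToFun {n} {m} x i ≡ finToFun y i) → x ≡ y
finToFun-injective {m} {n} x y eq = trans (sym (Fin.funToFin-finToFin {m} {n} x)) (trans (funToFin-cong eq) (Fin.funToFin-finToFin {m} {n} y))

prev : ∀ {n} → Fin (suc n) → Fin (suc n)
prev {n} zero = fromℕ n
prev (suc i) = inject₁ i

prev-injective : ∀ {n} {i j : Fin (suc n)} → prev i ≡ prev j → i ≡ j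
prev-injective {i = zero} {zero} _ = refl
prev-injective {i = zero} {suc j} eq = contradiction eq Fin.fromℕ≢inject₁
prev-injective {i = suc i} {zero} eq = contradiction (sym eq) Fin.fromℕ≢inject₁
prev-injective {i = suc i} {suc j} eq = cong suc (Fin.inject₁-injective eq)

prev-surjective : ∀ {n} (i : Fin (suc n)) → ∃ λ j → prev j ≡ i
prev-surjective i with view i
... | ‵fromℕ = zero , refl
... | ‵inject₁ j = suc j , refl

prev-≢ : ∀ {n} (i : Fin (2 + n)) → prev i ≢ i
prev-≢ zero ()
prev-≢ (suc i) eq = 1+n≢n (sym (trans (sym (Fin.toℕ-inject₁ i)) (cong toℕ eq)))

-- This is where a cycle of length at least four matters: a triangle that runs in one direction
-- would close up after three steps.
prev³-≢ : ∀ {n} (i : Fin (4 + n)) → prev (prev (prev i)) ≢ i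
prev³-≢ zero ()
prev³-≢ (suc zero) ()
prev³-≢ (suc (suc zero)) ()
prev³-≢ (suc (suc (suc i))) eq = m≢1+m+n (toℕ i) {2} (trans (sym toℕ-prev³) (trans (cong toℕ eq) (cong suc (+-comm 2 (toℕ i)))))
  where
  toℕ-prev³ : toℕ (inject₁ (inject₁ (inject₁ i))) ≡ toℕ i
  toℕ-prev³ = trans (Fin.toℕ-inject₁ (inject₁ (inject₁ i))) (trans (Fin.toℕ-inject₁ (inject₁ i)) (Fin.toℕ-inject₁ i))

-- A set is a cyclic word of length k over Fin q; its vertex in part e records the letters at
-- e - 1 and e, and consecutive parts are joined when they disagree on the letter they share.
-- The parts are arranged in a cycle of length at least four, so there is no triangle.
cycle : ∀ k q → Transversals (4 + k) (q * q) (q ^ (4 + k))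
cycle k q = record
  { R = R ; R? = λ u v → R₁? u v ⊎-dec R₁? v u ; R-sym = λ { (inj₁ r) → inj₂ r ; (inj₂ r) → inj₁ r }
  ; no-loop = λ { (inj₁ (p , _)) → prev-≢ _ (sym p) ; (inj₂ (p , _)) → prev-≢ _ (sym p) }
  ; no-triangle = λ uv vw uw → no-3-cycle (link uv) (link vw) (link uw)
  ; lab = lab ; lab-inj = lab-inj ; independent = independent ; maximal = maximal }
  where
  V = Fin (4 + k) × Fin (q * q)
  first second : Fin (q * q) → Fin q
  first l = proj₁ (remQuot {q} q l)
  second l = proj₂ (remQuot {q} q l)
  R₁ : V → V → Set
  R₁ (e , l) (e′ , l′) = e ≡ prev e′ × second l ≢ first l′
  R₁? : ∀ u v → Dec (R₁ u v)
  R₁? (e , l) (e′ , l′) = (e Fin.≟ prev e′) ×-dec ¬? (second l Fin.≟ first l′)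
  R : V → V → Set
  R u v = R₁ u v ⊎ R₁ v u
  Near : Fin (4 + k) → Fin (4 + k) → Set
  Near a b = a ≡ prev b ⊎ b ≡ prev a
  link : ∀ {u v} → R u v → Near (proj₁ u) (proj₁ v)
  link (inj₁ (p , _)) = inj₁ p
  link (inj₂ (p , _)) = inj₂ p
  fixed : ∀ {a b} → a ≡ prev b → a ≡ b → ⊥
  fixed p refl = prev-≢ _ (sym p)
  no-3-cycle : ∀ {a b c} → Near a b → Near b c → Near a c → ⊥
  no-3-cycle {b = b} {c} (inj₁ p) (inj₁ q) (inj₁ r) = fixed {b} {c} q (prev-injective (trans (sym p) r))
  no-3-cycle (inj₁ refl) (inj₁ refl) (inj₂ r) = prev³-≢ _ (sym r)
  no-3-cycle (inj₁ p) (inj₂ q) (inj₁ r) = fixed r (trans p (sym q))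
  no-3-cycle (inj₁ p) (inj₂ q) (inj₂ r) = fixed r (trans q (sym p))
  no-3-cycle {a} {c = c} (inj₂ p) (inj₁ q) (inj₁ r) = fixed {a} {c} r (prev-injective (trans (sym p) q))
  no-3-cycle {a} {c = c} (inj₂ p) (inj₁ q) (inj₂ r) = fixed {c} {a} r (sym (prev-injective (trans (sym p) q)))
  no-3-cycle (inj₂ refl) (inj₂ refl) (inj₁ r) = prev³-≢ _ (sym r)
  no-3-cycle (inj₂ p) (inj₂ q) (inj₂ r) = fixed q (trans r (sym p))
  word : Fin (q ^ (4 + k)) → Fin (4 + k) → Fin q
  word = finToFun
  lab : Fin (q ^ (4 + k)) → Fin (4 + k) → Fin (q * q)
  lab x e = combine (word x (prev e)) (word x e)
  first-lab : ∀ x e → first (lab x e) ≡ word x (prev e)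
  first-lab x e = cong proj₁ (Fin.remQuot-combine (word x (prev e)) (word x e))
  second-lab : ∀ x e → second (lab x e) ≡ word x e
  second-lab x e = cong proj₂ (Fin.remQuot-combine (word x (prev e)) (word x e))
  lab-inj : ∀ {x y} → (∀ e → lab x e ≡ lab y e) → x ≡ y
  lab-inj {x} {y} eq = finToFun-injective x y λ e → trans (sym (second-lab x e)) (trans (cong second (eq e)) (second-lab y e))
  apart : ∀ x e e′ → ¬ R₁ (e , lab x e) (e′ , lab x e′)
  apart x e e′ (refl , neq) = neq (trans (second-lab x e) (sym (first-lab x e′)))
  independent : ∀ x e e′ → ¬ R (e , lab x e) (e′ , lab x e′)
  independent x e e′ (inj₁ r) = apart x e e′ r
  independent x e e′ (inj₂ r) = apart x e′ e r
  -- A vertex off the word has a wrong second letter, which the word's vertex in the next part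
  -- detects, or a wrong first letter, which the one in the previous part detects.
  maximal : ∀ x e {l} → l ≢ lab x e → ∃ λ e′ → R (e , l) (e′ , lab x e′)
  maximal x e {l} neq with second l Fin.≟ word x e
  ... | no p = let (e′ , eq) = prev-surjective e in
          e′ , inj₁ (sym eq , λ r → p (trans r (trans (first-lab x e′) (cong (word x) eq))))
  ... | yes p with first l Fin.≟ word x (prev e)
  ...   | no r = prev e , inj₂ (refl , λ s → r (trans (sym s) (second-lab x (prev e))))
  ...   | yes r = contradiction (trans (sym (Fin.combine-remQuot {q} q l)) (cong₂ combine r p)) neq

lower : ∀ k {t₀ m₀ n t m} → MaximalIndependent t₀ m₀ n → k + suc t₀ ≡ t → k + suc m₀ ≤ m →
  Σ (System (3 + k) t m) λ X → size X ≡ n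
lower k {t₀} {m₀} {n} {m = m} M refl le =
  subst (λ m → Σ (System (3 + k) (k + suc t₀) m) λ X → size X ≡ n) total (build-system k j M)
  where
  j = m ∸ (k + suc m₀)
  total : k + (j + suc m₀) ≡ m
  total = trans (cong (k +_) (+-comm j (suc m₀))) (trans (sym (+-assoc k (suc m₀) j)) (m+[n∸m]≡n le))

-- Arithmetic, constants and assembly

shift : ∀ k m → m + 2 ∸ (3 + k) ≡ m ∸ suc k
shift k m = cong (_∸ (3 + k)) (+-comm m 2)

double≤⇒≤half : ∀ {x p} → x * 2 ≤ p → x ≤ ⌊ p /2⌋
double≤⇒≤half {x} le = ≤-trans (≤-reflexive (trans (n≡⌊n+n/2⌋ x) (cong ⌊_/2⌋ (trans (cong (x +_) (sym (+-identityʳ x))) (*-comm 2 x))))) (⌊n/2⌋-mono le)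

double-half≤ : ∀ p → 2 * ⌊ p /2⌋ ≤ p
double-half≤ p = ≤-trans (+-monoʳ-≤ ⌊ p /2⌋ (≤-trans (≤-reflexive (+-identityʳ _)) (⌊n/2⌋≤⌈n/2⌉ p))) (≤-reflexive (⌊n/2⌋+⌈n/2⌉≡n p))

≤1+double-half : ∀ p → p ≤ suc (2 * ⌊ p /2⌋)
≤1+double-half p = ≤-trans (≤-reflexive (sym (⌊n/2⌋+⌈n/2⌉≡n p))) (≤-trans (+-monoʳ-≤ ⌊ p /2⌋ (⌊n/2⌋-mono (n≤1+n (suc p))))
  (≤-reflexive (trans (+-suc ⌊ p /2⌋ ⌊ p /2⌋) (cong (λ x → suc (⌊ p /2⌋ + x)) (sym (+-identityʳ _))))))

-- Once m reaches suc k + b * 2, a family of at most b members also satisfies the second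
-- alternative, so both give the same floor.
half-bound : ∀ k {b m x} → suc k + b * 2 ≤ m → x ≤ b ⊎ suc k + x * 2 ≤ m → x ≤ ⌊ (m + 2 ∸ (3 + k)) /2⌋
half-bound k {b} {m} big (inj₁ x≤b) = half-bound k {b} big (inj₂ (≤-trans (+-monoʳ-≤ (suc k) (*-monoˡ-≤ 2 x≤b)) big))
half-bound k {m = m} {x} big (inj₂ le) = subst (λ p → x ≤ ⌊ p /2⌋) (sym (shift k m))
  (double≤⇒≤half (≤-trans (≤-reflexive (sym (m+n∸m≡n (suc k) (x * 2)))) (∸-monoˡ-≤ (suc k) le)))

absorb : ∀ {x y} a b → 1 ≤ y → x ≤ suc (a * (y * b)) → x ≤ suc (a * b) * y
absorb {y = y} a b 1≤y le = ≤-trans le (+-mono-≤ 1≤y (≤-reflexive (solve-lemma a y b)))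
  where
  solve-lemma : ∀ a y b → a * (y * b) ≡ a * b * y
  solve-lemma = solve-∀

^-distribʳ-* : ∀ n x y → (x * y) ^ n ≡ x ^ n * y ^ n
^-distribʳ-* zero x y = refl
^-distribʳ-* (suc n) x y = trans (cong (x * y *_) (^-distribʳ-* n x y)) (interchange x y (x ^ n) (y ^ n))
  where
  interchange : ∀ a b c d → a * b * (c * d) ≡ a * c * (b * d)
  interchange = solve-∀

-- The number q is the integer part of the square root of p / c. It is found by induction on p, as
-- raising p by one raises q by at most one.
scaled-root : ∀ c → 1 ≤ c → ∀ p → ∃ λ q → c * (q * q) ≤ p × p < c * (suc q * suc q)
scaled-root c 1≤c zero = 0 , ≤-reflexive (*-zeroʳ c) , ≤-trans 1≤c (≤-reflexive (sym (*-identityʳ c)))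
scaled-root c 1≤c (suc p) = step (scaled-root c 1≤c p)
  where
  step : (∃ λ q → c * (q * q) ≤ p × p < c * (suc q * suc q)) → ∃ λ q → c * (q * q) ≤ suc p × suc p < c * (suc q * suc q)
  step (q , lo , hi) with suc p <? c * (suc q * suc q)
  ... | yes lt = q , m≤n⇒m≤1+n lo , lt
  ... | no ¬lt = suc q , ≮⇒≥ ¬lt , ≤-<-trans hi (*-monoʳ-< c {{>-nonZero 1≤c}} (*-mono-< (n<1+n (suc q)) (n<1+n (suc q))))

-- Crown sets have size two; two isolated vertices and k cone vertices bring them to r + 1 = 4 + k.
-- The remaining p = m - (k + 2) vertices carry a crown with n = ⌊p/2⌋ sets.
lower₄ : ∀ k {t m} → t ≡ 4 + k → k + 4 ≤ m → Σ (System (3 + k) t m) λ X → m ≤ (k + 5) * size X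
lower₄ k {t} {m} refl M≤m = finish (lower k (Centred.base (isolate (transversal-family (crown n)))) (+-comm k 4) fits)
  where
  p = m ∸ (k + 2)
  p+ : p + (k + 2) ≡ m
  p+ = m∸n+n≡m (≤-trans (+-monoʳ-≤ k (s≤s (s≤s z≤n))) M≤m)
  n = ⌊ p /2⌋
  fits : k + suc (suc (2 * n)) ≤ m
  fits = ≤-trans (≤-reflexive (sym (+-assoc k 2 (2 * n)))) (≤-trans (+-monoʳ-≤ (k + 2) (double-half≤ p)) (≤-reflexive (trans (+-comm (k + 2) p) p+)))
  1≤n : 1 ≤ n
  1≤n = double≤⇒≤half {1} (+-cancelʳ-≤ (k + 2) 2 p (≤-trans (≤-reflexive (trans (+-comm 2 (k + 2)) (+-assoc k 2 2))) (≤-trans M≤m (≤-reflexive (sym p+)))))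
  -- From m ≤ (2n + 1) + (k + 2), where n ≥ 1 absorbs the constant k + 3.
  m≤ : m ≤ (k + 5) * n
  m≤ = ≤-trans (≤-reflexive (sym p+)) (≤-trans (+-monoˡ-≤ (k + 2) (≤1+double-half p))
         (≤-trans (≤-reflexive (regroup n k)) (≤-trans (+-monoʳ-≤ (2 * n) (≤-trans (≤-reflexive (sym (*-identityʳ (k + 3)))) (*-monoʳ-≤ (k + 3) 1≤n)))
           (≤-reflexive (recombine n k)))))
    where
    regroup : ∀ n k → suc (2 * n) + (k + 2) ≡ 2 * n + (k + 3)
    regroup = solve-∀
    recombine : ∀ n k → 2 * n + (k + 3) * n ≡ (k + 5) * n
    recombine = solve-∀
  finish : (Σ (System (3 + k) (4 + k) m) λ X → size X ≡ n) → Σ (System (3 + k) (4 + k) m) λ X → m ≤ (k + 5) * size X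
  finish (X , eq) = X , ≤-trans m≤ (≤-reflexive (cong ((k + 5) *_) (sym eq)))

-- Words of length c = 4 + s = t - r + 2 over q letters occupy c q² vertices, with q as large as
-- fits. Since q + 1 ≤ 2q, this gives m ≤ D q² with D = (k + 1) + 4c, and the square of q^c is
-- (q²)^c.
lower₅ : ∀ k s {t m} → t ≡ 5 + k + s → suc k + (4 + s) ≤ m →
  Σ (System (3 + k) t m) λ X → m ^ (4 + s) ≤ (suc k + 4 * (4 + s)) ^ (4 + s) * size X ^ 2
lower₅ k s {t} {m} refl M≤m = choose (scaled-root c (s≤s z≤n) p)
  where
  c = 4 + s
  D = suc k + 4 * c
  p = m ∸ suc k
  p+ : p + suc k ≡ m
  p+ = m∸n+n≡m (≤-trans (m≤m+n (suc k) c) M≤m)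
  c≤p : c ≤ p
  c≤p = +-cancelʳ-≤ (suc k) c p (≤-trans (≤-reflexive (+-comm c (suc k))) (≤-trans M≤m (≤-reflexive (sym p+))))
  choose : (∃ λ q → c * (q * q) ≤ p × p < c * (suc q * suc q)) → Σ (System (3 + k) (5 + k + s) m) λ X → m ^ c ≤ D ^ c * size X ^ 2
  -- An empty alphabet would mean p < c, which the threshold on m rules out.
  choose (zero , lo , hi) = contradiction c≤p (<⇒≱ (≤-trans hi (≤-reflexive (*-identityʳ c))))
  choose (suc q′ , lo , hi) = finish (lower k (transversal-family (cycle s q)) total fits)
    where
    q = suc q′
    total : k + suc c ≡ 5 + k + s
    total = lemma k s
      where
      lemma : ∀ k s → k + (5 + s) ≡ 5 + k + s
      lemma = solve-∀
    fits : k + suc (c * (q * q)) ≤ m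
    fits = ≤-trans (≤-reflexive (+-suc k _)) (≤-trans (+-monoʳ-≤ (suc k) lo) (≤-reflexive (trans (+-comm (suc k) p) p+)))
    m≤ : m ≤ D * (q * q)
    m≤ = ≤-trans (≤-reflexive (sym p+)) (≤-trans (+-monoˡ-≤ (suc k) (<⇒≤ hi)) (≤-trans (+-mono-≤ four one) (≤-reflexive (gather c k (q * q)))))
      where
      gather : ∀ c k y → 4 * c * y + suc k * y ≡ (suc k + 4 * c) * y
      gather = solve-∀
      1≤qq : 1 ≤ q * q
      1≤qq = s≤s z≤n
      one : suc k ≤ suc k * (q * q)
      one = ≤-trans (≤-reflexive (sym (*-identityʳ (suc k)))) (*-monoʳ-≤ (suc k) 1≤qq)
      four : c * (suc q * suc q) ≤ 4 * c * (q * q)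
      four = ≤-trans (*-monoʳ-≤ c (*-mono-≤ twice twice)) (≤-reflexive (square c q))
        where
        twice : suc q ≤ 2 * q
        twice = ≤-trans (+-monoˡ-≤ q (s≤s z≤n)) (≤-reflexive (cong (q +_) (sym (+-identityʳ q))))
        square : ∀ c q → c * (2 * q * (2 * q)) ≡ 4 * c * (q * q)
        square = solve-∀
    finish : (Σ (System (3 + k) (5 + k + s) m) λ X → size X ≡ q ^ c) → Σ (System (3 + k) (5 + k + s) m) λ X → m ^ c ≤ D ^ c * size X ^ 2
    finish (X , eq) = X , ≤-trans (^-monoˡ-≤ c m≤) (≤-reflexive (trans (^-distribʳ-* c D (q * q)) (cong (D ^ c *_)
      (trans (^-distribʳ-* c q q) (trans (cong (q ^ c *_) (sym (*-identityʳ (q ^ c)))) (cong (_^ 2) (sym eq)))))))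

upper₄′ : ∀ k {t m} → t ≡ 4 + k → 1 ≤ m → (X : System (3 + k) t m) → size X ≤ suc ((4 + k) ^ suc k * bound₄ k) * m
upper₄′ k refl 1≤m X = absorb ((4 + k) ^ suc k) (bound₄ k) 1≤m (upper₄ X)

upper₅′ : ∀ k n {t m} → t ≡ k + n → 1 ≤ m → (X : System (2 + k) t m) → size X ≤ suc ((k + n) ^ k * 1) * m ^ n
upper₅′ k n refl 1≤m X = absorb ((k + n) ^ k) 1 (m^n>0 _ {{>-nonZero 1≤m}} n) (upper₅ X)

upper₆′ : ∀ n {m} → 1 ≤ m → (X : System 3 (4 + n) m) → size X ≤ suc ((4 + n) ^ 1 * 12) * m ^ suc n
upper₆′ n {m} 1≤m X = absorb ((4 + n) ^ 1) 12 (m^n>0 m {{>-nonZero 1≤m}} (suc n))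
  (≤-trans (upper₆ X) (s≤s (*-monoʳ-≤ ((4 + n) ^ 1) (≤-reflexive (shuffle (m ^ n) m)))))
  where
  shuffle : ∀ x m → x * (m * 12) ≡ m * x * 12
  shuffle = solve-∀

-- The theorem asks for one constant that serves both bounds; the sum of the two separate constants
-- does.
widenʳ : ∀ a b c {x} → x ≤ a * c → x ≤ (a + b) * c
widenʳ a b c le = ≤-trans le (*-monoˡ-≤ c (m≤m+n a b))

widenˡ : ∀ a b c {x} → x ≤ b * c → x ≤ (a + b) * c
widenˡ a b c le = ≤-trans le (*-monoˡ-≤ c (m≤n+m b a))

theorem11 : (∀ (r : ℕ) → 3 ≤ r → Σ ℕ λ M → ∀ (m : ℕ) → M ≤ m → sIs r (r ∸ 2) m 1)
    × (∀ (r : ℕ) → 3 ≤ r → Σ ℕ λ M → ∀ (m : ℕ) → M ≤ m → sIs r (r ∸ 1) m 2)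
    × (∀ (r : ℕ) → 3 ≤ r → Σ ℕ λ M → ∀ (m : ℕ) → M ≤ m → sIs r r m ⌊ (m + 2 ∸ r) /2⌋)
    × (∀ (r : ℕ) → 3 ≤ r → Σ ℕ λ C → Σ ℕ λ M → ∀ (m : ℕ) → M ≤ m →
    Σ (System r (r + 1) m) (λ X → m ≤ C * size X)
    × (∀ (X : System r (r + 1) m) → size X ≤ C * m))
    × (∀ (r t : ℕ) → 3 ≤ r → r + 2 ≤ t → Σ ℕ λ C → Σ ℕ λ M → ∀ (m : ℕ) → M ≤ m →
    Σ (System r t m) (λ X → m ^ (t + 2 ∸ r) ≤ C * (size X ^ 2))
    × (∀ (X : System r t m) → size X ≤ C * m ^ (t + 2 ∸ r)))
    × (∀ (t : ℕ) → 5 ≤ t → Σ ℕ λ C → Σ ℕ λ M → ∀ (m : ℕ) → M ≤ m →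
    Σ (System 3 t m) (λ X → m ^ (t ∸ 1) ≤ C * (size X ^ 2))
    × (∀ (X : System 3 t m) → size X ≤ C * m ^ (t ∸ 3)))
theorem11 = part₁ , part₂ , part₃ , part₄ , part₅ , part₆
  where
  part₁ : ∀ r → 3 ≤ r → Σ ℕ λ M → ∀ m → M ≤ m → sIs r (r ∸ 2) m 1
  part₁ (suc (suc (suc k))) (s≤s (s≤s (s≤s z≤n))) = k + 1 , λ m M≤m →
    lower k (transversal-family trivial) (+-comm k 1) M≤m , upper₁

  part₂ : ∀ r → 3 ≤ r → Σ ℕ λ M → ∀ m → M ≤ m → sIs r (r ∸ 1) m 2
  part₂ (suc (suc (suc k))) (s≤s (s≤s (s≤s z≤n))) = k + 3 , λ m M≤m →
    lower k (transversal-family edge) (+-comm k 2) M≤m , upper₂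

  part₃ : ∀ r → 3 ≤ r → Σ ℕ λ M → ∀ m → M ≤ m → sIs r r m ⌊ (m + 2 ∸ r) /2⌋
  part₃ (suc (suc (suc k))) (s≤s (s≤s (s≤s z≤n))) = suc k + b * 2 , λ m M≤m →
    lower k (transversal-family (crown _)) (+-comm k 3) (fits m M≤m) , λ X → half-bound k {b} M≤m (upper₃ X)
    where
    b = suc ((3 + k) ^ suc k * bound₃ k)
    fits : ∀ m → suc k + b * 2 ≤ m → k + suc (2 * ⌊ (m + 2 ∸ (3 + k)) /2⌋) ≤ m
    fits m M≤m = ≤-trans (≤-reflexive (+-suc k _)) (≤-trans (+-monoʳ-≤ (suc k) (≤-trans (double-half≤ _) (≤-reflexive (shift k m))))
      (≤-reflexive (m+[n∸m]≡n (≤-trans (m≤m+n (suc k) (b * 2)) M≤m))))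

  part₄ : ∀ r → 3 ≤ r → Σ ℕ λ C → Σ ℕ λ M → ∀ m → M ≤ m →
    Σ (System r (r + 1) m) (λ X → m ≤ C * size X) × (∀ (X : System r (r + 1) m) → size X ≤ C * m)
  part₄ (suc (suc (suc k))) (s≤s (s≤s (s≤s z≤n))) = k + 5 + c , k + 4 , λ m M≤m →
    (let (X , le) = lower₄ k eq M≤m in X , widenʳ (k + 5) c (size X) le) ,
    λ X → widenˡ (k + 5) c m (upper₄′ k eq (≤-trans (m≤n+m 1 (k + 3)) (≤-trans (≤-reflexive (+-assoc k 3 1)) M≤m)) X)
    where
    c = suc ((4 + k) ^ suc k * bound₄ k)
    eq : 3 + k + 1 ≡ 4 + k
    eq = +-comm (3 + k) 1

  part₅ : ∀ r t → 3 ≤ r → r + 2 ≤ t → Σ ℕ λ C → Σ ℕ λ M → ∀ m → M ≤ m →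
    Σ (System r t m) (λ X → m ^ (t + 2 ∸ r) ≤ C * (size X ^ 2)) × (∀ (X : System r t m) → size X ≤ C * m ^ (t + 2 ∸ r))
  part₅ (suc (suc (suc k))) t (s≤s (s≤s (s≤s z≤n))) r+2≤t =
    subst (λ e → Σ ℕ λ C → Σ ℕ λ M → ∀ m → M ≤ m →
        Σ (System (3 + k) t m) (λ X → m ^ e ≤ C * (size X ^ 2)) × (∀ (X : System (3 + k) t m) → size X ≤ C * m ^ e)) (sym exponent)
      (c₁ + c₂ , suc k + (4 + s) , λ m M≤m →
        (let (X , le) = lower₅ k s t≡ M≤m in X , widenʳ c₁ c₂ (size X ^ 2) le) ,
        λ X → widenˡ c₁ c₂ (m ^ (4 + s)) (upper₅′ (suc k) (4 + s) (trans t≡ (split k s)) (≤-trans (s≤s z≤n) M≤m) X))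
    where
    s = t ∸ (3 + k + 2)
    c₁ = (suc k + 4 * (4 + s)) ^ (4 + s)
    c₂ = suc ((suc k + (4 + s)) ^ suc k * 1)
    regroup : ∀ k s → 3 + k + 2 + s ≡ 5 + k + s
    regroup = solve-∀
    split : ∀ k s → 5 + k + s ≡ suc k + (4 + s)
    split = solve-∀
    t≡ : t ≡ 5 + k + s
    t≡ = trans (sym (m+[n∸m]≡n r+2≤t)) (regroup k s)
    exponent : t + 2 ∸ (3 + k) ≡ 4 + s
    exponent = trans (shift k t) (trans (cong (_∸ suc k) (trans t≡ (split k s))) (m+n∸m≡n (suc k) (4 + s)))

  part₆ : ∀ t → 5 ≤ t → Σ ℕ λ C → Σ ℕ λ M → ∀ m → M ≤ m →
    Σ (System 3 t m) (λ X → m ^ (t ∸ 1) ≤ C * (size X ^ 2)) × (∀ (X : System 3 t m) → size X ≤ C * m ^ (t ∸ 3))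
  part₆ (suc (suc (suc (suc (suc s))))) (s≤s (s≤s (s≤s (s≤s (s≤s z≤n))))) = c₁ + c₂ , 5 + s , λ m M≤m →
    (let (X , le) = lower₅ 0 s refl M≤m in X , widenʳ c₁ c₂ (size X ^ 2) le) ,
    λ X → widenˡ c₁ c₂ (m ^ (2 + s)) (upper₆′ (suc s) (≤-trans (s≤s z≤n) M≤m) X)
    where
    c₁ = (1 + 4 * (4 + s)) ^ (4 + s)
    c₂ = suc ((5 + s) ^ 1 * 12)
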